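{- Let $0<p<1$ and let $X_1,\ldots,X_n$ be independent random variables, each following the same distribution as a random variable $X\sim b(p)$. Let $S_n=\sum_{i=1}^n X_i$. Then, for any $r$ such that $0<r<p$ or, equivalently, writing $r=(1-\delta)p$, for any $\delta$ such that $0<\delta<1$, $$P(S_n\le rn)=P(S_n\le(1-\delta)pn)\le\left(\frac{e^r\cdot p^r}{e^p\cdot r^r}\right)^n=\left(\frac{e^{ -\delta}}{(1-\delta)^{(1-\delta)}}\right)^{pn}.$$
   Context: $b(p)$ denotes the Bernoulli distribution with $P(X=1)=p$, $P(X=0)=1-p$. Here $n\ge 1$ is an integer. -}

module Defs where

open import Algebra.Bundles using (CommutativeRing; Semiring)
import Algebra.Definitions.RawSemiring as RawSemiringDefs
open import Data.Bool.Base using (if_then_else_)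
open import Data.Fin.Base using (Fin; toℕ)
open import Data.Integer.Base as ℤ using (ℤ)
open import Data.Nat.Base as ℕ using (ℕ; suc; _!)
open import Data.Product.Base using (_×_; ∃-syntax)
open import Function.Base using (_∘_)
open import Level using (0ℓ) renaming (suc to lsuc)
open import Relation.Binary.Core using (Rel)
import Relation.Binary.Construct.NonStrictToStrict as ToStrict
open import Relation.Binary.Structures using (IsDecTotalOrder)
open import Relation.Binary.PropositionalEquality.Core using (_≡_)
open import Relation.Nullary.Decidable.Core using (does)
open import Relation.Nullary.Negation.Core using (¬_)
open import Relation.Unary using (Pred; _∈_; _≐_; U; ∁; ⋃; ⋂; Satisfiable; Empty; _∩_)

------------------------------------------------------------------------
-- The real numbers, as a Dedekind-complete totally ordered field (such a
-- field is unique up to isomorphism).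
--
-- The intended reading is classical: with excluded middle, ℝ is a model,
-- and conversely `_≤?_` together with `sup` gives excluded middle in Set.

-- "Least" is expressed by the approximation property: every number below s
-- is exceeded by an element of A.  Classically this says that no smaller
-- upper bound exists; constructively it also provides the element.
record IsSupremum {R : Set} (_≤_ _<_ : Rel R 0ℓ) (A : Pred R 0ℓ) (s : R) : Set where
  field
    upper : ∀ {x} → x ∈ A → x ≤ s
    least : ∀ {y} → y < s → ∃[ x ] x ∈ A × y < x

record RealField : Set₁ where
  infix  4 _≤_
  infix  9 _⁻¹
  field
    commutativeRing : CommutativeRing 0ℓ 0ℓ

  open CommutativeRing commutativeRing public

  field
    _≤_             : Rel Carrier 0ℓ
    isDecTotalOrder : IsDecTotalOrder _≈_ _≤_

  open ToStrict _≈_ _≤_ public using (_<_)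

  field
    0≉1       : ¬ 0# ≈ 1#
    +-monoˡ-≤ : ∀ z {x y} → x ≤ y → x + z ≤ y + z
    *-nonNeg  : ∀ {x y} → 0# ≤ x → 0# ≤ y → 0# ≤ x * y

    -- Total, with unspecified value at 0.
    _⁻¹       : Carrier → Carrier
    *-inverse : ∀ {x} → ¬ x ≈ 0# → x * x ⁻¹ ≈ 1#

    -- Total, with unspecified value on sets that are empty or unbounded above.
    sup       : Pred Carrier 0ℓ → Carrier
    complete  : ∀ {A} → Satisfiable A → (∃[ u ] ∀ {x} → x ∈ A → x ≤ u) →
                IsSupremum _≤_ _<_ A (sup A)

  open IsDecTotalOrder isDecTotalOrder public using (_≤?_)

module Analysis (ℝ : RealField) where

  open RealField ℝ public using
    (Carrier; _≈_; _≤_; _<_; _+_; _*_; _-_; -_; 0#; 1#; _⁻¹)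
  open RealField ℝ using (_≤?_; sup)
  open RawSemiringDefs (Semiring.rawSemiring (RealField.semiring ℝ)) public using (_^_; sum; product)
    renaming (_×_ to _ℕ×_)

  infixl 7 _/_
  infixr 8 _^ℤ_ _^ʳ_

  _/_ : Carrier → Carrier → Carrier
  x / y = x * y ⁻¹

  fromℕ : ℕ → Carrier
  fromℕ n = n ℕ× 1#

  fromℤ : ℤ → Carrier
  fromℤ (ℤ.+ n)    = fromℕ n
  fromℤ ℤ.-[1+ n ] = - fromℕ (suc n)

  _^ℤ_ : Carrier → ℤ → Carrier
  x ^ℤ (ℤ.+ n)    = x ^ n
  x ^ℤ ℤ.-[1+ n ] = (x ^ suc n) ⁻¹

  PartialSums : (ℕ → Carrier) → Pred Carrier 0ℓ
  PartialSums a x = ∃[ k ] x ≈ sum {k} (λ i → a (toℕ i))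

  -- The sum of a series of nonnegative terms.
  IsSeriesSum : (ℕ → Carrier) → Carrier → Set
  IsSeriesSum a = IsSupremum _≤_ _<_ (PartialSums a)

  e : Carrier
  e = sup (PartialSums (λ k → fromℕ (k !) ⁻¹))

  -- For b ≥ 1 and real x, bˣ is the supremum of b^(m/n) over the rationals
  -- m/n ≤ x.  The set below is the set of positive y with y ≤ b^(m/n), i.e.
  -- yⁿ ≤ bᵐ, for some such m/n.
  PowersBelow : Carrier → Carrier → Pred Carrier 0ℓ
  PowersBelow b x y = 0# < y × ∃[ m ] ∃[ n ]
    1 ℕ.≤ n × fromℤ m ≤ x * fromℕ n × y ^ n ≤ b ^ℤ m

  -- For 0 < b < 1, bˣ = (1/b)⁻ˣ.  No meaning is attached to b ≤ 0.
  _^ʳ_ : Carrier → Carrier → Carrier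
  b ^ʳ x = if does (1# ≤? b)
           then sup (PowersBelow b x)
           else sup (PowersBelow (b ⁻¹) (- x))

  ------------------------------------------------------------------------
  -- Probability

  record IsSigmaAlgebra {Ω : Set} (ℱ : Pred (Pred Ω 0ℓ) (lsuc 0ℓ)) : Set₁ where
    field
      resp       : ∀ {A B} → A ≐ B → ℱ A → ℱ B
      whole      : ℱ U
      complement : ∀ {A} → ℱ A → ℱ (∁ A)
      union      : ∀ {A : ℕ → Pred Ω 0ℓ} → (∀ k → ℱ (A k)) → ℱ (⋃ ℕ A)

  -- The σ-algebra generated by the half-lines (-∞, a].
  data Borel : Pred (Pred Carrier 0ℓ) (lsuc 0ℓ) where
    halfLine   : ∀ a → Borel (_≤ a)
    resp       : ∀ {A B} → A ≐ B → Borel A → Borel B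
    whole      : Borel U
    complement : ∀ {A} → Borel A → Borel (∁ A)
    union      : ∀ {A : ℕ → Pred Carrier 0ℓ} → (∀ k → Borel (A k)) → Borel (⋃ ℕ A)

  record ProbabilitySpace : Set₂ where
    field
      Ω              : Set
      IsEvent        : Pred (Pred Ω 0ℓ) (lsuc 0ℓ)
      isSigmaAlgebra : IsSigmaAlgebra IsEvent

      -- Defined on all subsets, but only constrained on events.
      P              : Pred Ω 0ℓ → Carrier
      P-cong         : ∀ {A B} → IsEvent A → A ≐ B → P A ≈ P B
      P-nonNeg       : ∀ {A} → IsEvent A → 0# ≤ P A
      P-whole        : P U ≈ 1#
      P-σ-additive   : ∀ {A : ℕ → Pred Ω 0ℓ} → (∀ k → IsEvent (A k)) →
                       (∀ {j k} → ¬ j ≡ k → Empty (A j ∩ A k)) →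
                       IsSeriesSum (P ∘ A) (P (⋃ ℕ A))

    IsRandomVariable : (Ω → Carrier) → Set₁
    IsRandomVariable X = ∀ {B} → Borel B → IsEvent (B ∘ X)

    Independent : ∀ {n} → (Fin n → Ω → Carrier) → Set₁
    Independent {n} X = ∀ {B : Fin n → Pred Carrier 0ℓ} → (∀ i → Borel (B i)) →
      P (⋂ (Fin n) (λ i → B i ∘ X i)) ≈ product (λ i → P (B i ∘ X i))

    _∼b_ : (Ω → Carrier) → Carrier → Set
    X ∼b p = P (λ ω → X ω ≈ 1#) ≈ p × P (λ ω → X ω ≈ 0#) ≈ 1# - p

-- Weighting each outcome of (X₁, …, Xₙ) with S ≤ rn by (p/r)^(rn - S) ≥ 1 turns the
-- weights p, 1 - p of the two values of each Xᵢ into r, 1 - p and costs a factor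
-- (p/r)^(rn); summing over all outcomes gives
--   P (S ≤ rn) ≤ (p/r)^(rn) (1 - (p - r))ⁿ ≤ (p/r)^(rn) e^(-(p - r)n).
-- The laws of real powers come from a characterisation of w = bˣ up to bounded
-- factors, namely wᴺ ~ b^k whenever the integer k stays within bounded distance
-- of xN: the laws only have to be checked for integer exponents, up to constants.
module Submission where

open import Defs
open import Algebra.Bundles using (RawRing)
open import Algebra.Solver.Ring.AlmostCommutativeRing
  using (fromCommutativeRing; _-Raw-AlmostCommutative⟶_)
open import Data.Bool.Base using (Bool; true; false)
open import Data.Fin.Base using (Fin; zero; suc; toℕ)
open import Data.Integer.Base as ℤ using (ℤ)
open import Data.Maybe.Base using (Maybe; just; nothing)
open import Data.Nat.Base as ℕ using (ℕ; zero; suc; z≤n; s≤s; _≥_; _!)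
import Data.Nat.Properties as ℕ
open import Data.Product.Base using (_×_; _,_; proj₁; proj₂; ∃-syntax)
open import Data.Sum.Base using (_⊎_; inj₁; inj₂)
open import Data.Vec.Functional using ([]; _∷_)
open import Function.Base using (_∘_)
open import Function.Bundles using (_⇔_; mk⇔)
open import Level using (0ℓ) renaming (suc to lsuc)
open import Relation.Binary.Bundles using (Poset)
open import Relation.Binary.PropositionalEquality.Core as ≡ using (_≡_)
open import Relation.Binary.Structures using (IsDecTotalOrder)
open import Relation.Nullary.Decidable.Core using (Dec; yes; no)
open import Relation.Nullary.Negation.Core using (¬_; contradiction)
open import Relation.Unary
  using (Pred; _∈_; _⊆_; _≐_; U; ∅; ∁; ⋃; ⋂; Satisfiable; Empty; _∩_; _∪_)

-- The factor `p / r` is the value of `q` that minimises `q^r e^(p/q - p)`, the n-th root of the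
-- estimate that a general `q` would give. The definition of real powers changes its form at base 1:
-- `p`, `r` and `1# - δ` lie below 1, `e` and `p / r` above, so that a law such as
-- `p^r / r^r = (p/r)^r` compares suprema of unrelated sets. Constant factors do no harm when N-th
-- powers are compared for all N, because a positive number with bounded powers is at most 1. The
-- estimate `1 - u ≤ e^(-u)` has to link such a supremum to the series that defines `e`. A
-- truncation E of the exponential series satisfies `(1 - y) E(a + y) ≤ E(a)` for nonnegative `a`
-- and `y`; N steps of length 1/N from 0 to 1 give `e (1 - 1/N)^N ≤ 1`, and Bernoulli's inequality
-- carries this over to real `u`.

-- Ordered field arithmetic, with a ring solver over integer coefficients.

module OrderedField (ℝ : RealField) where

  open RealField ℝ hiding (refl; sym; trans; zero)
  open RealField ℝ using () renaming (refl to ≈-refl; sym to ≈-sym; trans to ≈-trans) public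
  open Analysis ℝ using (_^_; fromℕ)
  open import Algebra.Properties.Ring ring
    using (-‿distribˡ-*; -‿distribʳ-*; -0#≈0#; -‿+-comm; -‿involutive)
  open import Algebra.Properties.Semiring.Mult semiring
    using () renaming (×-homo-+ to ×ᵤ-homo-+; ×1-homo-* to ×ᵤ1-homo-*)
  open import Algebra.Properties.Semiring.Mult.TCOptimised semiring
    using (×-homo-+; ×1-homo-*) renaming (_×_ to _×ₒ_)
  open import Algebra.Properties.CommutativeSemiring.Exp commutativeSemiring public
    using (^-congˡ; ^-congʳ; ^-homo-*; ^-assocʳ; ^-distrib-*)

  private
    module Coefficients where
      open import Algebra.Properties.CommutativeSemigroup +-commutativeSemigroup
      open import Relation.Binary.Reasoning.Setoid setoid

      -- A pair (m , n) stands for the integer m - n; equal normal forms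
      -- must be syntactically equal, so one component is always kept at zero.
      normalise : ℕ × ℕ → ℕ × ℕ
      normalise (a , b) = a ℕ.∸ b , b ℕ.∸ a

      Diff : RawRing _ _
      Diff = record
        { Carrier = ℕ × ℕ
        ; _≈_     = _≡_
        ; _+_     = λ (a , b) (c , d) → normalise (a ℕ.+ c , b ℕ.+ d)
        ; _*_     = λ (a , b) (c , d) → normalise (a ℕ.* c ℕ.+ b ℕ.* d , a ℕ.* d ℕ.+ b ℕ.* c)
        ; -_      = λ (a , b) → b , a
        ; 0#      = 0 , 0
        ; 1#      = 1 , 0
        }

      -- The separate clause for a zero second component lets the constants 0 and 1 evaluate to `0#`
      -- and `1#` themselves, so that solved equations match goals as written.
      ⟦_⟧ : ℕ × ℕ → Carrier
      ⟦ a , zero ⟧  = a ×ₒ 1#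
      ⟦ a , suc b ⟧ = a ×ₒ 1# - suc b ×ₒ 1#

      ⟦⟧-diff : ∀ a b → ⟦ a , b ⟧ ≈ a ×ₒ 1# - b ×ₒ 1#
      ⟦⟧-diff a zero    = ≈-sym (≈-trans (+-congˡ -0#≈0#) (+-identityʳ _))
      ⟦⟧-diff a (suc b) = ≈-refl

      +-diff : ∀ x y z w → (x + z) - (y + w) ≈ (x - y) + (z - w)
      +-diff x y z w = ≈-trans (+-congˡ (≈-sym (-‿+-comm y w))) (interchange x z (- y) (- w))

      *-diff : ∀ x y z w → (x * z + y * w) - (x * w + y * z) ≈ (x - y) * (z - w)
      *-diff x y z w = ≈-sym (begin
        (x - y) * (z - w)                               ≈⟨ distribʳ _ _ _ ⟩
        x * (z - w) + (- y) * (z - w)                   ≈⟨ +-cong (distribˡ _ _ _) (distribˡ _ _ _) ⟩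
        (x * z + x * - w) + (- y * z + - y * - w)
          ≈⟨ +-cong (+-congˡ (≈-sym (-‿distribʳ-* x w))) (+-cong (≈-sym (-‿distribˡ-* y z)) -y*-w≈yw) ⟩
        (x * z + - (x * w)) + (- (y * z) + y * w)       ≈⟨ +-congˡ (+-comm _ _) ⟩
        (x * z + - (x * w)) + (y * w + - (y * z))       ≈⟨ +-diff _ _ _ _ ⟨
        (x * z + y * w) - (x * w + y * z)               ∎)
        where
        -y*-w≈yw : - y * - w ≈ y * w
        -y*-w≈yw = begin
          - y * - w       ≈⟨ -‿distribˡ-* y (- w) ⟨
          - (y * - w)     ≈⟨ -‿cong (-‿distribʳ-* y w) ⟨
          - (- (y * w))   ≈⟨ -‿involutive _ ⟩
          y * w           ∎

      neg-diff : ∀ x y → y - x ≈ - (x - y)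
      neg-diff x y = begin
        y - x          ≈⟨ +-comm _ _ ⟩
        - x + y        ≈⟨ +-congˡ (-‿involutive y) ⟨
        - x + - (- y)  ≈⟨ -‿+-comm x (- y) ⟩
        - (x - y)      ∎

      ⟦⟧-cong : ∀ a b c d → a ℕ.+ d ≡ c ℕ.+ b → ⟦ a , b ⟧ ≈ ⟦ c , d ⟧
      ⟦⟧-cong a b c d eq = begin
        ⟦ a , b ⟧                  ≈⟨ ⟦⟧-diff a b ⟩
        A - B                      ≈⟨ +-identityʳ _ ⟨
        (A - B) + 0#               ≈⟨ +-congˡ (-‿inverseʳ D) ⟨
        (A - B) + (D - D)          ≈⟨ +-diff A B D D ⟨
        (A + D) - (B + D)          ≈⟨ +-congʳ a+d≈c+b ⟩
        (C + B) - (B + D)          ≈⟨ +-congˡ (-‿cong (+-comm B D)) ⟩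
        (C + B) - (D + B)          ≈⟨ +-diff C D B B ⟩
        (C - D) + (B - B)          ≈⟨ +-congˡ (-‿inverseʳ B) ⟩
        (C - D) + 0#               ≈⟨ +-identityʳ _ ⟩
        C - D                      ≈⟨ ⟦⟧-diff c d ⟨
        ⟦ c , d ⟧                  ∎
        where
        A = a ×ₒ 1# ; B = b ×ₒ 1# ; C = c ×ₒ 1# ; D = d ×ₒ 1#
        a+d≈c+b : A + D ≈ C + B
        a+d≈c+b = ≈-trans (≈-sym (×-homo-+ 1# a d)) (≈-trans (reflexive (≡.cong (_×ₒ 1#) eq)) (×-homo-+ 1# c b))

      balance : ∀ a b → a ℕ.∸ b ℕ.+ b ≡ a ℕ.+ (b ℕ.∸ a)
      balance zero    zero    = ≡.refl
      balance zero    (suc b) = ≡.refl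
      balance (suc a) zero    = ≡.refl
      balance (suc a) (suc b) = ≡.trans (ℕ.+-suc (a ℕ.∸ b) b) (≡.cong suc (balance a b))

      ⟦normalise⟧ : ∀ a b → ⟦ normalise (a , b) ⟧ ≈ a ×ₒ 1# - b ×ₒ 1#
      ⟦normalise⟧ a b = ≈-trans (⟦⟧-cong (a ℕ.∸ b) (b ℕ.∸ a) a b (balance a b)) (⟦⟧-diff a b)

      morphism : Diff -Raw-AlmostCommutative⟶ fromCommutativeRing commutativeRing
      morphism = record
        { ⟦_⟧    = ⟦_⟧
        ; +-homo = λ (a , b) (c , d) → begin
            ⟦ normalise (a ℕ.+ c , b ℕ.+ d) ⟧           ≈⟨ ⟦normalise⟧ (a ℕ.+ c) (b ℕ.+ d) ⟩
            (a ℕ.+ c) ×ₒ 1# - (b ℕ.+ d) ×ₒ 1#           ≈⟨ +-cong (×-homo-+ 1# a c) (-‿cong (×-homo-+ 1# b d)) ⟩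
            (a ×ₒ 1# + c ×ₒ 1#) - (b ×ₒ 1# + d ×ₒ 1#)   ≈⟨ +-diff _ _ _ _ ⟩
            (a ×ₒ 1# - b ×ₒ 1#) + (c ×ₒ 1# - d ×ₒ 1#)   ≈⟨ +-cong (⟦⟧-diff a b) (⟦⟧-diff c d) ⟨
            ⟦ a , b ⟧ + ⟦ c , d ⟧                       ∎
        ; *-homo = λ (a , b) (c , d) → begin
            ⟦ normalise (a ℕ.* c ℕ.+ b ℕ.* d , a ℕ.* d ℕ.+ b ℕ.* c) ⟧
              ≈⟨ ⟦normalise⟧ (a ℕ.* c ℕ.+ b ℕ.* d) (a ℕ.* d ℕ.+ b ℕ.* c) ⟩
            (a ℕ.* c ℕ.+ b ℕ.* d) ×ₒ 1# - (a ℕ.* d ℕ.+ b ℕ.* c) ×ₒ 1#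
              ≈⟨ +-cong (+* a c b d) (-‿cong (+* a d b c)) ⟩
            ((a ×ₒ 1#) * (c ×ₒ 1#) + (b ×ₒ 1#) * (d ×ₒ 1#)) - ((a ×ₒ 1#) * (d ×ₒ 1#) + (b ×ₒ 1#) * (c ×ₒ 1#))
              ≈⟨ *-diff _ _ _ _ ⟩
            (a ×ₒ 1# - b ×ₒ 1#) * (c ×ₒ 1# - d ×ₒ 1#)   ≈⟨ *-cong (⟦⟧-diff a b) (⟦⟧-diff c d) ⟨
            ⟦ a , b ⟧ * ⟦ c , d ⟧                       ∎
        ; -‿homo = λ (a , b) → ≈-trans (⟦⟧-diff b a) (≈-trans (neg-diff _ _) (-‿cong (≈-sym (⟦⟧-diff a b))))
        ; 0-homo = ≈-refl
        ; 1-homo = ≈-refl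
        }
        where
        +* : ∀ a c b d → (a ℕ.* c ℕ.+ b ℕ.* d) ×ₒ 1# ≈ (a ×ₒ 1#) * (c ×ₒ 1#) + (b ×ₒ 1#) * (d ×ₒ 1#)
        +* a c b d = ≈-trans (×-homo-+ 1# (a ℕ.* c) (b ℕ.* d)) (+-cong (×1-homo-* a c) (×1-homo-* b d))

      coeff≟ : ∀ p q → Maybe (⟦ p ⟧ ≈ ⟦ q ⟧)
      coeff≟ (a , b) (c , d) with a ℕ.+ d ℕ.≟ c ℕ.+ b
      ... | yes eq = just (⟦⟧-cong a b c d eq)
      ... | no _   = nothing

  open import Algebra.Solver.Ring Coefficients.Diff (fromCommutativeRing commutativeRing)
    Coefficients.morphism Coefficients.coeff≟ public
    using (Polynomial; solve; con; _:+_; _:*_; _:-_; :-_; _:=_)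

  :0 :1 :2 : ∀ {n} → Polynomial n
  :0 = con (0 , 0)
  :1 = con (1 , 0)
  :2 = con (2 , 0)

  poset : Poset _ _ _
  poset = record { isPartialOrder = IsDecTotalOrder.isPartialOrder isDecTotalOrder }

  module ≤-Reasoning where
    open import Relation.Binary.Reasoning.PartialOrder poset public

  open IsDecTotalOrder isDecTotalOrder public using (total)
    renaming (refl to ≤-refl; trans to ≤-trans; reflexive to ≤-reflexive; antisym to ≤-antisym)
  open IsDecTotalOrder isDecTotalOrder using (≤-respˡ-≈; ≤-respʳ-≈) public

  ≰⇒> : ∀ {x y} → ¬ x ≤ y → y < x
  ≰⇒> {x} {y} x≰y with total x y
  ... | inj₁ x≤y = contradiction x≤y x≰y
  ... | inj₂ y≤x = y≤x , λ y≈x → x≰y (≤-reflexive (≈-sym y≈x))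

  <⇒≱ : ∀ {x y} → x < y → ¬ y ≤ x
  <⇒≱ (x≤y , x≉y) y≤x = x≉y (≤-antisym x≤y y≤x)

  <⇒≤ : ∀ {x y} → x < y → x ≤ y
  <⇒≤ = proj₁

  ≮⇒≥ : ∀ {x y} → ¬ x < y → y ≤ x
  ≮⇒≥ {x} {y} x≮y with y ≤? x
  ... | yes y≤x = y≤x
  ... | no  y≰x = contradiction (≰⇒> y≰x) x≮y

  <-≤-trans : ∀ {x y z} → x < y → y ≤ z → x < z
  <-≤-trans {x} {y} {z} x<y y≤z = begin-strict x <⟨ x<y ⟩ y ≤⟨ y≤z ⟩ z ∎
    where open ≤-Reasoning

  ≤-<-trans : ∀ {x y z} → x ≤ y → y < z → x < z
  ≤-<-trans {x} {y} {z} x≤y y<z = begin-strict x ≤⟨ x≤y ⟩ y <⟨ y<z ⟩ z ∎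
    where open ≤-Reasoning

  <-respʳ-≈ : ∀ {x y z} → y ≈ z → x < y → x < z
  <-respʳ-≈ y≈z x<y = <-≤-trans x<y (≤-reflexive y≈z)

  <-respˡ-≈ : ∀ {x y z} → y ≈ z → y < x → z < x
  <-respˡ-≈ y≈z y<x = ≤-<-trans (≤-reflexive (≈-sym y≈z)) y<x

  ≤-resp₂-≈ : ∀ {x y z w} → x ≈ z → y ≈ w → x ≤ y → z ≤ w
  ≤-resp₂-≈ x≈z y≈w x≤y = ≤-respˡ-≈ x≈z (≤-respʳ-≈ y≈w x≤y)

  ≤-by : ∀ {x y d} → 0# ≤ d → x + d ≈ y → x ≤ y
  ≤-by {x} {y} {d} 0≤d eq = ≤-resp₂-≈ (+-identityˡ x) (≈-trans (+-comm d x) eq) (+-monoˡ-≤ x 0≤d)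

  x≤y⇒0≤y-x : ∀ {x y} → x ≤ y → 0# ≤ y - x
  x≤y⇒0≤y-x {x} x≤y = ≤-respˡ-≈ (-‿inverseʳ x) (+-monoˡ-≤ (- x) x≤y)

  0≤y-x⇒x≤y : ∀ {x y} → 0# ≤ y - x → x ≤ y
  0≤y-x⇒x≤y {x} {y} p = ≤-by p (solve 2 (λ x y → x :+ (y :- x) := y) ≈-refl x y)

  x<y⇒0<y-x : ∀ {x y} → x < y → 0# < y - x
  x<y⇒0<y-x {x} {y} (x≤y , x≉y) = x≤y⇒0≤y-x x≤y , λ eq →
    x≉y (≈-trans (≈-sym (+-identityʳ x)) (≈-trans (+-congˡ eq) (solve 2 (λ x y → x :+ (y :- x) := y)
        ≈-refl x y)))

  0<y-x⇒x<y : ∀ {x y} → 0# < y - x → x < y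
  0<y-x⇒x<y {x} {y} (p , q) = 0≤y-x⇒x≤y p , λ x≈y → q (≈-sym (≈-trans (+-congʳ (≈-sym x≈y)) (-‿inverseʳ x)))

  +-mono-≤ : ∀ {x y u v} → x ≤ y → u ≤ v → x + u ≤ y + v
  +-mono-≤ {x} {y} {u} {v} x≤y u≤v = ≤-trans (+-monoˡ-≤ u x≤y)
    (≤-resp₂-≈ (+-comm u y) (+-comm v y) (+-monoˡ-≤ y u≤v))

  +-cancelʳ-≤ : ∀ z {x y} → x + z ≤ y + z → x ≤ y
  +-cancelʳ-≤ z {x} {y} p = ≤-resp₂-≈ (cancel x) (cancel y) (+-monoˡ-≤ (- z) p)
    where
    cancel : ∀ x → (x + z) - z ≈ x
    cancel x = solve 2 (λ x z → (x :+ z) :- z := x) ≈-refl x z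

  +-nonNeg : ∀ {x y} → 0# ≤ x → 0# ≤ y → 0# ≤ x + y
  +-nonNeg 0≤x 0≤y = ≤-respˡ-≈ (+-identityˡ 0#) (+-mono-≤ 0≤x 0≤y)

  +-pos-nonNeg : ∀ {x y} → 0# < x → 0# ≤ y → 0# < x + y
  +-pos-nonNeg {x} {y} 0<x 0≤y = <-≤-trans 0<x (≤-by 0≤y ≈-refl)

  neg-mono-≤ : ∀ {x y} → x ≤ y → - y ≤ - x
  neg-mono-≤ {x} {y} x≤y = ≤-by (x≤y⇒0≤y-x x≤y) (solve 2 (λ x y → (:- y) :+ (y :- x) := :- x) ≈-refl x y)

  *-monoˡ-≤ : ∀ {z x y} → 0# ≤ z → x ≤ y → z * x ≤ z * y
  *-monoˡ-≤ {z} {x} {y} 0≤z x≤y = ≤-by (*-nonNeg 0≤z (x≤y⇒0≤y-x x≤y))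
    (solve 3 (λ x y z → z :* x :+ z :* (y :- x) := z :* y) ≈-refl x y z)

  *-monoʳ-≤ : ∀ {z x y} → 0# ≤ z → x ≤ y → x * z ≤ y * z
  *-monoʳ-≤ {z} {x} {y} 0≤z x≤y = ≤-resp₂-≈ (*-comm z x) (*-comm z y) (*-monoˡ-≤ 0≤z x≤y)

  *-mono-≤ : ∀ {x y u v} → 0# ≤ u → 0# ≤ y → x ≤ y → u ≤ v → x * u ≤ y * v
  *-mono-≤ 0≤u 0≤y x≤y u≤v = ≤-trans (*-monoʳ-≤ 0≤u x≤y) (*-monoˡ-≤ 0≤y u≤v)

  pos⇒≉0 : ∀ {x} → 0# < x → ¬ x ≈ 0#
  pos⇒≉0 0<x x≈0 = proj₂ 0<x (≈-sym x≈0)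

  0≤1 : 0# ≤ 1#
  0≤1 with total 0# 1#
  ... | inj₁ 0≤1 = 0≤1
  ... | inj₂ 1≤0 = ≤-respʳ-≈ (solve 0 (:- :1 :* :- :1 := :1) ≈-refl) (*-nonNeg 0≤-1 0≤-1)
    where
    0≤-1 : 0# ≤ - 1#
    0≤-1 = ≤-respˡ-≈ -0#≈0# (neg-mono-≤ 1≤0)

  0<1 : 0# < 1#
  0<1 = 0≤1 , 0≉1

  *-inverseʳ : ∀ {x} → 0# < x → x * x ⁻¹ ≈ 1#
  *-inverseʳ 0<x = *-inverse (pos⇒≉0 0<x)

  *-inverseˡ : ∀ {x} → 0# < x → x ⁻¹ * x ≈ 1#
  *-inverseˡ {x} 0<x = ≈-trans (*-comm _ _) (*-inverseʳ 0<x)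

  x*y≈0⇒y≈0 : ∀ {x y} → 0# < x → x * y ≈ 0# → y ≈ 0#
  x*y≈0⇒y≈0 {x} {y} 0<x xy≈0 = begin
    y                 ≈⟨ *-identityˡ y ⟨
    1# * y            ≈⟨ *-congʳ (*-inverseˡ 0<x) ⟨
    x ⁻¹ * x * y      ≈⟨ *-assoc _ _ _ ⟩
    x ⁻¹ * (x * y)    ≈⟨ *-congˡ xy≈0 ⟩
    x ⁻¹ * 0#         ≈⟨ zeroʳ _ ⟩
    0#                ∎
    where open import Relation.Binary.Reasoning.Setoid setoid

  *-pos : ∀ {x y} → 0# < x → 0# < y → 0# < x * y
  *-pos 0<x 0<y = *-nonNeg (<⇒≤ 0<x) (<⇒≤ 0<y) ,
    λ 0≈xy → pos⇒≉0 0<y (x*y≈0⇒y≈0 0<x (≈-sym 0≈xy))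

  *-cancelʳ-≤ : ∀ {x y z} → 0# < z → x * z ≤ y * z → x ≤ y
  *-cancelʳ-≤ {x} {y} {z} 0<z xz≤yz with x ≤? y
  ... | yes x≤y = x≤y
  ... | no  x≰y = contradiction xz≤yz (<⇒≱ (0<y-x⇒x<y
    (<-respʳ-≈ (solve 3 (λ x y z → (x :- y) :* z := x :* z :- y :* z) ≈-refl x y z)
      (*-pos (x<y⇒0<y-x (≰⇒> x≰y)) 0<z))))

  *-cancelʳ-< : ∀ {x y z} → 0# ≤ z → x * z < y * z → x < y
  *-cancelʳ-< 0≤z xz<yz = ≰⇒> λ y≤x → <⇒≱ xz<yz (*-monoʳ-≤ 0≤z y≤x)

  *-monoʳ-< : ∀ {x y z} → 0# < z → x < y → x * z < y * z
  *-monoʳ-< 0<z x<y = ≰⇒> λ yz≤xz → <⇒≱ x<y (*-cancelʳ-≤ 0<z yz≤xz)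

  ⁻¹-pos : ∀ {x} → 0# < x → 0# < x ⁻¹
  ⁻¹-pos {x} 0<x = *-cancelʳ-< (<⇒≤ 0<x)
    (<-respˡ-≈ (≈-sym (zeroˡ x)) (<-respʳ-≈ (≈-sym (*-inverseˡ 0<x)) 0<1))

  fromℕ-+ : ∀ m n → fromℕ (m ℕ.+ n) ≈ fromℕ m + fromℕ n
  fromℕ-+ = ×ᵤ-homo-+ 1#

  fromℕ-* : ∀ m n → fromℕ (m ℕ.* n) ≈ fromℕ m * fromℕ n
  fromℕ-* = ×ᵤ1-homo-*

  fromℕ-1 : fromℕ 1 ≈ 1#
  fromℕ-1 = +-identityʳ 1#

  fromℕ-nonNeg : ∀ n → 0# ≤ fromℕ n
  fromℕ-nonNeg zero    = ≤-refl
  fromℕ-nonNeg (suc n) = +-nonNeg 0≤1 (fromℕ-nonNeg n)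

  fromℕ-suc-pos : ∀ n → 0# < fromℕ (suc n)
  fromℕ-suc-pos n = +-pos-nonNeg 0<1 (fromℕ-nonNeg n)

  fromℕ-pos : ∀ {n} → 1 ℕ.≤ n → 0# < fromℕ n
  fromℕ-pos {suc n} _ = fromℕ-suc-pos n

  fromℕ-mono-≤ : ∀ {m n} → m ℕ.≤ n → fromℕ m ≤ fromℕ n
  fromℕ-mono-≤ {n = n} z≤n = fromℕ-nonNeg n
  fromℕ-mono-≤ (s≤s m≤n) = +-mono-≤ ≤-refl (fromℕ-mono-≤ m≤n)

  fromℕ-cancel-≤ : ∀ {m n} → fromℕ m ≤ fromℕ n → m ℕ.≤ n
  fromℕ-cancel-≤ {m} {n} p with m ℕ.≤? n
  ... | yes m≤n = m≤n
  ... | no  m≰n = contradiction (≤-trans (fromℕ-mono-≤ (ℕ.≰⇒> m≰n)) p)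
    (<⇒≱ (0<y-x⇒x<y (<-respʳ-≈ (solve 1 (λ x → :1 := (:1 :+ x) :- x) ≈-refl (fromℕ n)) 0<1)))

  ^-nonNeg : ∀ {x} n → 0# ≤ x → 0# ≤ x ^ n
  ^-nonNeg zero    0≤x = 0≤1
  ^-nonNeg (suc n) 0≤x = *-nonNeg 0≤x (^-nonNeg n 0≤x)

  ^-pos : ∀ {x} n → 0# < x → 0# < x ^ n
  ^-pos zero    0<x = 0<1
  ^-pos (suc n) 0<x = *-pos 0<x (^-pos n 0<x)

  ^-mono-≤ : ∀ {x y} n → 0# ≤ x → x ≤ y → x ^ n ≤ y ^ n
  ^-mono-≤ zero    0≤x x≤y = ≤-refl
  ^-mono-≤ (suc n) 0≤x x≤y = *-mono-≤ (^-nonNeg n 0≤x) (≤-trans 0≤x x≤y) x≤y (^-mono-≤ n 0≤x x≤y)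

  1^n≈1 : ∀ n → 1# ^ n ≈ 1#
  1^n≈1 zero    = ≈-refl
  1^n≈1 (suc n) = ≈-trans (*-identityˡ _) (1^n≈1 n)

  1≤x⇒1≤x^n : ∀ {x} n → 1# ≤ x → 1# ≤ x ^ n
  1≤x⇒1≤x^n n 1≤x = ≤-respˡ-≈ (1^n≈1 n) (^-mono-≤ n 0≤1 1≤x)

  ^-monoʳ-≤ : ∀ {x m n} → 1# ≤ x → m ℕ.≤ n → x ^ m ≤ x ^ n
  ^-monoʳ-≤ {n = n} 1≤x z≤n = 1≤x⇒1≤x^n n 1≤x
  ^-monoʳ-≤ 1≤x (s≤s m≤n)   = *-monoˡ-≤ (≤-trans 0≤1 1≤x) (^-monoʳ-≤ 1≤x m≤n)

  ^-mono-< : ∀ {x y} n → 1 ℕ.≤ n → 0# ≤ x → x < y → x ^ n < y ^ n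
  ^-mono-< {x} {y} (suc n) _ 0≤x x<y =
    ≤-<-trans (*-monoˡ-≤ 0≤x (^-mono-≤ n 0≤x (<⇒≤ x<y)))
              (*-monoʳ-< (^-pos n (≤-<-trans 0≤x x<y)) x<y)

  ^-cancel-≤ : ∀ {x y} n → 1 ℕ.≤ n → 0# ≤ y → x ^ n ≤ y ^ n → x ≤ y
  ^-cancel-≤ n 1≤n 0≤y p = ≮⇒≥ λ y<x → <⇒≱ (^-mono-< n 1≤n 0≤y y<x) p

  bernoulli : ∀ {h} n → 0# ≤ h → 1# + fromℕ n * h ≤ (1# + h) ^ n
  bernoulli {h} zero    0≤h = ≤-reflexive (≈-trans (+-congˡ (zeroˡ h)) (+-identityʳ 1#))
  bernoulli {h} (suc n) 0≤h = begin
    1# + (1# + fromℕ n) * h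
      ≤⟨ ≤-by (*-nonNeg (fromℕ-nonNeg n) (*-nonNeg 0≤h 0≤h))
         (solve 2 (λ h n → (:1 :+ (:1 :+ n) :* h) :+ n :* (h :* h) := (:1 :+ h) :* (:1 :+ n :* h))
             ≈-refl h (fromℕ n)) ⟩
    (1# + h) * (1# + fromℕ n * h)
      ≤⟨ *-monoˡ-≤ (+-nonNeg 0≤1 0≤h) (bernoulli n 0≤h) ⟩
    (1# + h) ^ suc n ∎
    where open ≤-Reasoning

  -- The bound `h ≤ 1#` keeps the factor `1# - h` nonnegative, so that the induction hypothesis can
  -- be multiplied by it; each step gives away `n h²`.
  bernoulli⁻ : ∀ {h} n → 0# ≤ h → h ≤ 1# → 1# - fromℕ n * h ≤ (1# - h) ^ n
  bernoulli⁻ {h} zero    0≤h h≤1 = ≤-reflexive (solve 1 (λ h → :1 :- :0 :* h := :1) ≈-refl h)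
  bernoulli⁻ {h} (suc n) 0≤h h≤1 = begin
    1# - (1# + fromℕ n) * h
      ≤⟨ ≤-by (*-nonNeg (fromℕ-nonNeg n) (*-nonNeg 0≤h 0≤h))
         (solve 2 (λ h n → (:1 :- (:1 :+ n) :* h) :+ n :* (h :* h) := (:1 :- h) :* (:1 :- n :* h))
             ≈-refl h (fromℕ n)) ⟩
    (1# - h) * (1# - fromℕ n * h)
      ≤⟨ *-monoˡ-≤ (x≤y⇒0≤y-x h≤1) (bernoulli⁻ n 0≤h h≤1) ⟩
    (1# - h) ^ suc n ∎
    where open ≤-Reasoning

  -- Consequences of completeness: classical logic, Archimedes, integer parts.

  IsSup : Pred Carrier 0ℓ → Carrier → Set
  IsSup = IsSupremum _≤_ _<_

  sup-≤ : ∀ {A s u} → IsSup A s → (∀ {x} → x ∈ A → x ≤ u) → s ≤ u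
  sup-≤ isSup A≤u = ≮⇒≥ λ u<s → let (x , x∈A , u<x) = IsSupremum.least isSup u<s in <⇒≱ u<x (A≤u x∈A)

  -- The supremum of {0} ∪ {1 | P} is positive exactly when P holds.
  excluded-middle : (P : Set) → Dec P
  excluded-middle P = decide (sup A ≤? 0#)
    where
    A : Pred Carrier 0ℓ
    A x = x ≈ 0# ⊎ (x ≈ 1# × P)
    A≤1 : ∀ {x} → x ∈ A → x ≤ 1#
    A≤1 (inj₁ x≈0)       = ≤-respˡ-≈ (≈-sym x≈0) 0≤1
    A≤1 (inj₂ (x≈1 , _)) = ≤-reflexive x≈1
    isSup : IsSup A (sup A)
    isSup = complete (0# , inj₁ ≈-refl) (1# , A≤1)
    decide : Dec (sup A ≤ 0#) → Dec P
    decide (yes s≤0) = no λ p → <⇒≱ 0<1 (≤-trans (IsSupremum.upper isSup (inj₂ (≈-refl , p))) s≤0)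
    decide (no  s≰0) with IsSupremum.least isSup (≰⇒> s≰0)
    ... | x , inj₁ x≈0 , 0<x     = contradiction x≈0 (pos⇒≉0 0<x)
    ... | x , inj₂ (_ , p) , 0<x = yes p

  x<x+1 : ∀ x → x < x + 1#
  x<x+1 x = 0<y-x⇒x<y (<-respʳ-≈ (solve 1 (λ x → :1 := (x :+ :1) :- x) ≈-refl x) 0<1)

  -- Otherwise the natural numbers have a supremum `s`, and the successor of a natural number above
  -- `s - 1#` exceeds it. Excluded middle turns this contradiction into a witness.
  archimedean : ∀ x → ∃[ n ] x ≤ fromℕ n
  archimedean x with excluded-middle (∃[ n ] x ≤ fromℕ n)
  ... | yes p = p
  ... | no ¬p = contradiction (IsSupremum.least isSup s-1<s) λ where
      (y , (n , y≈n) , s-1<y) → <⇒≱ s-1<y (≤-by (x≤y⇒0≤y-x (IsSupremum.upper isSup (suc n , ≈-refl)))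
        (≈-trans (+-congʳ y≈n) (solve 2 (λ s n → n :+ (s :- (:1 :+ n)) := s :- :1) ≈-refl s (fromℕ n))))
    where
    Naturals : Pred Carrier 0ℓ
    Naturals y = ∃[ n ] y ≈ fromℕ n
    s = sup Naturals
    isSup : IsSup Naturals s
    isSup = complete (0# , 0 , ≈-refl)
      (x , λ (n , y≈n) → ≤-respˡ-≈ (≈-sym y≈n) (≮⇒≥ λ x<n → ¬p (n , <⇒≤ x<n)))
    s-1<s : s - 1# < s
    s-1<s = <-respʳ-≈ (solve 1 (λ s → (s :- :1) :+ :1 := s) ≈-refl s) (x<x+1 (s - 1#))

  -- A downward search from an Archimedean bound. Both inequalities are weak: the roundings only
  -- have to stay within distance one.
  floor⁺ : ∀ {x} → 0# ≤ x → ∃[ i ] fromℕ i ≤ x × x ≤ fromℕ i + 1#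
  floor⁺ {x} 0≤x = let (n , x≤n) = archimedean x in search n x≤n
    where
    search : ∀ n → x ≤ fromℕ n → ∃[ i ] fromℕ i ≤ x × x ≤ fromℕ i + 1#
    search zero    x≤0 = 0 , 0≤x , ≤-trans x≤0 (+-nonNeg ≤-refl 0≤1)
    search (suc n) x≤1+n with x ≤? fromℕ n
    ... | yes x≤n = search n x≤n
    ... | no  x≰n = n , <⇒≤ (≰⇒> x≰n) , ≤-respʳ-≈ (+-comm 1# (fromℕ n)) x≤1+n

  -- i - j is the integer part of x.
  floor : ∀ x → ∃[ i ] ∃[ j ] fromℕ i ≤ x + fromℕ j × x + fromℕ j ≤ fromℕ i + 1#
  floor x = let (j , -x≤j) = archimedean (- x)
                (i , p , q) = floor⁺ {x + fromℕ j}
                  (≤-by (x≤y⇒0≤y-x -x≤j) (solve 2 (λ x j → :0 :+ (j :- (:- x)) := x :+ j) ≈-refl x (fromℕ j)))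
            in i , j , p , q

  -- If `q` were `1# + h` with `h` positive, Bernoulli would push its powers past `B` once
  -- `n ≥ B / h`. This is what upgrades agreement up to constant factors to equality.
  bounded-powers⇒≤1 : ∀ {q B} → 0# < q → (∀ n → q ^ n ≤ B) → q ≤ 1#
  bounded-powers⇒≤1 {q} {B} 0<q q^n≤B = ≮⇒≥ λ 1<q →
    let h       = q - 1#
        0<h     = x<y⇒0<y-x 1<q
        (n , p) = archimedean (B * h ⁻¹)
        bound : 1# + fromℕ n * h ≤ B
        bound = ≤-trans (bernoulli n (<⇒≤ 0<h))
                  (≤-respˡ-≈ (^-congˡ n (solve 1 (λ q → q := :1 :+ (q :- :1)) ≈-refl q)) (q^n≤B n))
        B≤nh : B ≤ fromℕ n * h
        B≤nh = ≤-respˡ-≈ (≈-trans (*-assoc _ _ _) (≈-trans (*-congˡ (*-inverseˡ 0<h)) (*-identityʳ B)))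
            (*-monoʳ-≤ (<⇒≤ 0<h) p)
    in <⇒≱ (<-respʳ-≈ (+-comm _ 1#) (x<x+1 (fromℕ n * h))) (≤-trans bound B≤nh)

-- Characterisation of real powers up to bounded factors, and their laws.

module Powers (ℝ : RealField) where

  open RealField ℝ hiding (refl; sym; trans; zero)
  open Analysis ℝ using (_^_; _/_; fromℕ)
  open OrderedField ℝ

  -- The absolute value of `d` is at most `C`. The bound is a natural number so that it can be
  -- absorbed into an integer power `b ^ C`.
  record Near (C : ℕ) (d : Carrier) : Set where
    constructor between
    field
      lower : - fromℕ C ≤ d
      upper : d ≤ fromℕ C

  near-cong : ∀ {C d e} → d ≈ e → Near C d → Near C e
  near-cong d≈e (between p q) = between (≤-respʳ-≈ d≈e p) (≤-respˡ-≈ d≈e q)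

  near-+ : ∀ {C D d e} → Near C d → Near D e → Near (C ℕ.+ D) (d + e)
  near-+ {C} {D} (between p q) (between p′ q′) = between
    (≤-respˡ-≈ (≈-trans (solve 2 (λ c d → :- c :+ :- d := :- (c :+ d))
        ≈-refl (fromℕ C) (fromℕ D)) (-‿cong (≈-sym (fromℕ-+ C D)))) (+-mono-≤ p p′))
    (≤-respʳ-≈ (≈-sym (fromℕ-+ C D)) (+-mono-≤ q q′))

  near-neg : ∀ {C d} → Near C d → Near C (- d)
  near-neg {C} (between p q) = between (neg-mono-≤ q)
    (≤-respʳ-≈ (solve 1 (λ c → :- (:- c) := c) ≈-refl (fromℕ C)) (neg-mono-≤ p))

  -- `D` is any natural number above the absolute value of `x`; the sign of `x` decides which bound
  -- on `d` yields which bound on the product.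
  near-* : ∀ x → ∃[ D ] ∀ {d} → Near 1 d → Near D (x * d)
  near-* x with total 0# x
  ... | inj₁ 0≤x = D , bound
    where
    D   = proj₁ (archimedean x)
    x≤D = proj₂ (archimedean x)
    bound : ∀ {d} → Near 1 d → Near D (x * d)
    bound {d} (between p q) = between
      (≤-trans (neg-mono-≤ x≤D) (≤-respˡ-≈ (solve 1 (λ x → x :* (:- (:1 :+ :0)) := :- x)
          ≈-refl x) (*-monoˡ-≤ 0≤x p)))
      (≤-trans (≤-respʳ-≈ (solve 1 (λ x → x :* (:1 :+ :0) := x) ≈-refl x) (*-monoˡ-≤ 0≤x q)) x≤D)
  ... | inj₂ x≤0 = D , bound
    where
    D    = proj₁ (archimedean (- x))
    -x≤D = proj₂ (archimedean (- x))
    0≤-x : 0# ≤ - x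
    0≤-x = ≤-respˡ-≈ (solve 0 (:- :0 := :0) ≈-refl) (neg-mono-≤ x≤0)
    bound : ∀ {d} → Near 1 d → Near D (x * d)
    bound {d} (between p q) = between
      (≤-trans (neg-mono-≤ -x≤D) (≤-resp₂-≈ (solve 1 (λ x → :- (:- x :* (:1 :+ :0)) := :- (:- x)) ≈-refl x)
        (solve 2 (λ x d → :- ((:- x) :* d) := x :* d) ≈-refl x d) (neg-mono-≤ (*-monoˡ-≤ 0≤-x q))))
      (≤-trans (≤-resp₂-≈ (solve 2 (λ x d → (:- x) :* (:- d) := x :* d) ≈-refl x d)
        (solve 1 (λ x → (:- x) :* (:- (:- (:1 :+ :0))) := :- x) ≈-refl x) (*-monoˡ-≤ 0≤-x (neg-mono-≤ p))) -x≤D)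

  near-floor : ∀ x → ∃[ i ] ∃[ j ] Near 1 (x + fromℕ j - fromℕ i)
  near-floor x = let (i , j , p , q) = floor x in i , j , between
    (≤-trans (≤-respˡ-≈ (solve 0 (:0 :- :1 := :- (:1 :+ :0)) ≈-refl)
        (+-mono-≤ (x≤y⇒0≤y-x p) (≤-reflexive ≈-refl)))
      (≤-by 0≤1 (solve 2 (λ x i → (x :- i :- :1) :+ :1 := x :- i) ≈-refl (x + fromℕ j) (fromℕ i))))
    (≤-respʳ-≈ (solve 1 (λ i → (i :+ :1) :- i := :1 :+ :0) ≈-refl (fromℕ i)) (+-monoˡ-≤ (- fromℕ i) q))

  -- Agreement up to a factor `B`. One constant serves both directions, which makes the relation
  -- symmetric; under products the constants multiply.
  Sim : Carrier → Carrier → Carrier → Set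
  Sim B x y = x ≤ B * y × y ≤ B * x

  sim-cong : ∀ {B x y u v} → x ≈ u → y ≈ v → Sim B x y → Sim B u v
  sim-cong x≈u y≈v (p , q) = ≤-resp₂-≈ x≈u (*-congˡ y≈v) p , ≤-resp₂-≈ y≈v (*-congˡ x≈u) q

  sim-sym : ∀ {B x y} → Sim B x y → Sim B y x
  sim-sym (p , q) = q , p

  sim-scale : ∀ {B x y z} → 0# ≤ z → Sim B x y → Sim B (x * z) (y * z)
  sim-scale 0≤z (p , q) =
    ≤-respʳ-≈ (*-assoc _ _ _) (*-monoʳ-≤ 0≤z p) , ≤-respʳ-≈ (*-assoc _ _ _) (*-monoʳ-≤ 0≤z q)

  sim-cancel : ∀ {B x y z} → 0# < z → Sim B (x * z) (y * z) → Sim B x y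
  sim-cancel 0<z (p , q) =
    *-cancelʳ-≤ 0<z (≤-respʳ-≈ (≈-sym (*-assoc _ _ _)) p) , *-cancelʳ-≤ 0<z
        (≤-respʳ-≈ (≈-sym (*-assoc _ _ _)) q)

  sim-* : ∀ {A B x y u v} → 0# ≤ x → 0# ≤ u → 0# ≤ y → 0# ≤ v →
          Sim A x y → Sim B u v → Sim (A * B) (x * u) (y * v)
  sim-* {A} {B} 0≤x 0≤u 0≤y 0≤v (p , q) (p′ , q′) =
    ≤-respʳ-≈ (interchange A _ B _) (*-mono-≤ 0≤u (≤-trans 0≤x p) p p′) ,
    ≤-respʳ-≈ (interchange A _ B _) (*-mono-≤ 0≤v (≤-trans 0≤y q) q q′)
    where
    interchange : ∀ a x b y → (a * x) * (b * y) ≈ (a * b) * (x * y)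
    interchange = solve 4 (λ a x b y → (a :* x) :* (b :* y) := (a :* b) :* (x :* y)) ≈-refl

  -- wᴺ agrees with b^(i - j) up to a factor independent of N whenever
  -- x N is within bounded distance of the integer i - j.  By Archimedes
  -- this pins down w = bˣ, and it is stable under the operations on powers.
  record IsPow (b x w : Carrier) : Set where
    field
      positive : 0# < w
      bounds   : ∀ C → ∃[ B ] ∀ N i j → Near C (x * fromℕ N + fromℕ j - fromℕ i) →
                 Sim B (w ^ N * b ^ j) (b ^ i)

  open IsPow

  isPow-cong : ∀ {b c x y v w} → b ≈ c → x ≈ y → v ≈ w → IsPow b x v → IsPow c y w
  isPow-cong b≈c x≈y v≈w P .positive = <-respʳ-≈ v≈w (P .positive)
  isPow-cong b≈c x≈y v≈w P .bounds C = let (B , sim) = P .bounds C in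
    B , λ N i j near →
      sim-cong (*-cong (^-congˡ N v≈w) (^-congˡ j b≈c)) (^-congˡ i b≈c)
        (sim N i j (near-cong (+-congʳ (+-congʳ (*-congʳ (≈-sym x≈y)))) near))

  *-/-cancel : ∀ {x y} → 0# < y → x * y ⁻¹ * y ≈ x
  *-/-cancel {x} 0<y = ≈-trans (*-assoc _ _ _) (≈-trans (*-congˡ (*-inverseˡ 0<y)) (*-identityʳ x))

  private
    -- With `i - j` the rounding of `x N`, both `v ^ N * b ^ j` and `w ^ N * b ^ j` agree with
    -- `b ^ i`. Hence `(v / w) ^ N ≤ A * B` for every `N`, and bounded powers force `v / w ≤ 1#`.
    isPow-≤ : ∀ {b x v w} → 0# < b → IsPow b x v → IsPow b x w → v ≤ w
    isPow-≤ {b} {x} {v} {w} 0<b P Q = ≤-resp₂-≈ (*-/-cancel (Q .positive)) (*-identityˡ w)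
      (*-monoʳ-≤ (<⇒≤ (Q .positive)) (bounded-powers⇒≤1 {v / w} {A * B}
          (*-pos (P .positive) (⁻¹-pos (Q .positive))) λ N →
        let (i , j , near) = near-floor (x * fromℕ N)
            p = proj₁ (simP N i j near)
            q = proj₂ (simQ N i j near)
            0<bʲ = ^-pos j 0<b
            0<wᴺ = ^-pos N (Q .positive)
            -- `Sim` does not record the sign of its constant; here `A * b ^ i` lies above a
            -- positive number.
            0≤A : 0# ≤ A
            0≤A = <⇒≤ (*-cancelʳ-< (<⇒≤ (^-pos i 0<b))
                (<-respˡ-≈ (≈-sym (zeroˡ _)) (<-≤-trans (*-pos (^-pos N (P .positive)) 0<bʲ) p)))
        in *-cancelʳ-≤ 0<wᴺ (*-cancelʳ-≤ 0<bʲ (begin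
            (v / w) ^ N * w ^ N * b ^ j   ≈⟨ *-congʳ (^-distrib-* (v / w) w N) ⟨
            (v / w * w) ^ N * b ^ j       ≈⟨ *-congʳ (^-congˡ N (*-/-cancel (Q .positive))) ⟩
            v ^ N * b ^ j                 ≤⟨ p ⟩
            A * b ^ i                     ≤⟨ *-monoˡ-≤ 0≤A q ⟩
            A * (B * (w ^ N * b ^ j))
              ≈⟨ solve 4 (λ a b w c → a :* (b :* (w :* c)) := a :* b :* w :* c) ≈-refl A B (w ^ N) (b ^ j) ⟩
            A * B * w ^ N * b ^ j         ∎))))
      where
      open ≤-Reasoning
      A    = proj₁ (P .bounds 1)
      simP = proj₂ (P .bounds 1)
      B    = proj₁ (Q .bounds 1)
      simQ = proj₂ (Q .bounds 1)

  isPow-unique : ∀ {b x v w} → 0# < b → IsPow b x v → IsPow b x w → v ≈ w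
  isPow-unique 0<b P Q = ≤-antisym (isPow-≤ 0<b P Q) (isPow-≤ 0<b Q P)

  isPow-distrib-* : ∀ {a b x v w} → 0# < a → 0# < b → IsPow a x v → IsPow b x w → IsPow (a * b) x (v * w)
  isPow-distrib-* 0<a 0<b P Q .positive = *-pos (P .positive) (Q .positive)
  isPow-distrib-* {a} {b} {x} {v} {w} 0<a 0<b P Q .bounds C =
    let (A , simP) = P .bounds C
        (B , simQ) = Q .bounds C
    in A * B , λ N i j near → sim-cong
        (≈-trans (solve 4 (λ v a w b → (v :* a) :* (w :* b) := (v :* w) :* (a :* b))
            ≈-refl (v ^ N) (a ^ j) (w ^ N) (b ^ j))
          (≈-sym (*-cong (^-distrib-* v w N) (^-distrib-* a b j))))
        (≈-sym (^-distrib-* a b i))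
        (sim-* (<⇒≤ (*-pos (^-pos N (P .positive)) (^-pos j 0<a)))
            (<⇒≤ (*-pos (^-pos N (Q .positive)) (^-pos j 0<b)))
          (<⇒≤ (^-pos i 0<a)) (<⇒≤ (^-pos i 0<b)) (simP N i j near) (simQ N i j near))

  -- Round `x N` to `k - l`. Then `y N` is within `C + 1` of `(i - j) - (k - l)`; multiplying the
  -- two comparisons leaves the common factor `b ^ k * b ^ l`, which cancels.
  isPow-+ : ∀ {b x y v w} → 0# < b → IsPow b x v → IsPow b y w → IsPow b (x + y) (v * w)
  isPow-+ 0<b P Q .positive = *-pos (P .positive) (Q .positive)
  isPow-+ {b} {x} {y} {v} {w} 0<b P Q .bounds C = A * B , sim
    where
    A    = proj₁ (P .bounds 1)
    simP = proj₂ (P .bounds 1)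
    B    = proj₁ (Q .bounds (C ℕ.+ 1))
    simQ = proj₂ (Q .bounds (C ℕ.+ 1))
    sim : ∀ N i j → Near C ((x + y) * fromℕ N + fromℕ j - fromℕ i) → Sim (A * B) ((v * w) ^ N * b ^ j) (b ^ i)
    sim N i j near = sim-cancel (*-pos (^-pos k 0<b) (^-pos l 0<b))
      (sim-cong left right
        (sim-* (<⇒≤ (*-pos (^-pos N (P .positive)) (^-pos l 0<b)))
            (<⇒≤ (*-pos (^-pos N (Q .positive)) (^-pos (j ℕ.+ k) 0<b)))
          (<⇒≤ (^-pos k 0<b)) (<⇒≤ (^-pos (i ℕ.+ l) 0<b)) (simP N k l near-x)
          (simQ N (i ℕ.+ l) (j ℕ.+ k) (near-cong diff (near-+ near (near-neg near-x))))))
      where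
      k = proj₁ (near-floor (x * fromℕ N))
      l = proj₁ (proj₂ (near-floor (x * fromℕ N)))
      near-x : Near 1 (x * fromℕ N + fromℕ l - fromℕ k)
      near-x = proj₂ (proj₂ (near-floor (x * fromℕ N)))
      diff : ((x + y) * fromℕ N + fromℕ j - fromℕ i) + - (x * fromℕ N + fromℕ l - fromℕ k)
             ≈ y * fromℕ N + fromℕ (j ℕ.+ k) - fromℕ (i ℕ.+ l)
      diff = ≈-trans
        (solve 7 (λ x y n i j k l → ((x :+ y) :* n :+ j :- i) :+ :- (x :* n :+ l :- k) := y :* n :+
            (j :+ k) :- (i :+ l)) ≈-refl
          x y (fromℕ N) (fromℕ i) (fromℕ j) (fromℕ k) (fromℕ l))
        (≈-sym (+-cong (+-congˡ (fromℕ-+ j k)) (-‿cong (fromℕ-+ i l))))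
      left : (v ^ N * b ^ l) * (w ^ N * b ^ (j ℕ.+ k)) ≈ (v * w) ^ N * b ^ j * (b ^ k * b ^ l)
      left = ≈-trans (*-congˡ (*-congˡ (^-homo-* b j k))) (≈-trans
        (solve 5 (λ v w j k l → (v :* l) :* (w :* (j :* k)) := (v :* w) :* j :* (k :* l))
            ≈-refl (v ^ N) (w ^ N) (b ^ j) (b ^ k) (b ^ l))
        (*-congʳ (*-congʳ (≈-sym (^-distrib-* v w N)))))
      right : b ^ k * b ^ (i ℕ.+ l) ≈ b ^ i * (b ^ k * b ^ l)
      right = ≈-trans (*-congˡ (^-homo-* b i l))
        (solve 3 (λ i k l → k :* (i :* l) := i :* (k :* l)) ≈-refl (b ^ i) (b ^ k) (b ^ l))

  -- To evaluate vᴺ with v = wʸ and w = bˣ, round y N to k - l and x l to m - n.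
  isPow-* : ∀ {b x y v w} → 0# < b → IsPow b x w → IsPow w y v → IsPow b (x * y) v
  isPow-* 0<b P Q .positive = Q .positive
  isPow-* {b} {x} {y} {v} {w} 0<b P Q .bounds C = Q₁ * P₁ * P₂ , sim
    where
    D    = proj₁ (near-* x)
    Q₁   = proj₁ (Q .bounds 1)
    simQ = proj₂ (Q .bounds 1)
    P₁   = proj₁ (P .bounds 1)
    simP = proj₂ (P .bounds 1)
    -- The three terms are the given distance, the error of rounding `x l`, and `x` times the error
    -- of rounding `y N`.
    P₂   = proj₁ (P .bounds (C ℕ.+ 1 ℕ.+ D))
    simR = proj₂ (P .bounds (C ℕ.+ 1 ℕ.+ D))
    sim : ∀ N i j → Near C (x * y * fromℕ N + fromℕ j - fromℕ i) → Sim (Q₁ * P₁ * P₂) (v ^ N * b ^ j) (b ^ i)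
    -- Multiply `v^N w^l ~ w^k`, `b^m ~ w^l b^n` and `w^k b^(n+j) ~ b^(m+i)`, then cancel
    -- `w^k w^l b^m b^n`.
    sim N i j near = sim-cancel (*-pos (*-pos (w^-pos k) (w^-pos l)) (*-pos (b^-pos m) (b^-pos n)))
      (sim-cong left right
        (sim-* (<⇒≤ (*-pos vw (b^-pos m))) (<⇒≤ wb) (<⇒≤ (*-pos (w^-pos k) (*-pos (w^-pos l) (b^-pos n))))
            (<⇒≤ (b^-pos (m ℕ.+ i)))
          (sim-* (<⇒≤ vw) (<⇒≤ (b^-pos m)) (<⇒≤ (w^-pos k)) (<⇒≤ (*-pos (w^-pos l) (b^-pos n)))
            (simQ N k l near-y) (sim-sym (simP l m n near-x)))
          (simR k (m ℕ.+ i) (n ℕ.+ j)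
            (near-cong diff (near-+ (near-+ near near-x) (near-neg (proj₂ (near-* x) near-y)))))))
      where
      w^-pos : ∀ n → 0# < w ^ n
      w^-pos n = ^-pos n (P .positive)
      b^-pos : ∀ n → 0# < b ^ n
      b^-pos n = ^-pos n 0<b
      k = proj₁ (near-floor (y * fromℕ N))
      l = proj₁ (proj₂ (near-floor (y * fromℕ N)))
      near-y : Near 1 (y * fromℕ N + fromℕ l - fromℕ k)
      near-y = proj₂ (proj₂ (near-floor (y * fromℕ N)))
      m = proj₁ (near-floor (x * fromℕ l))
      n = proj₁ (proj₂ (near-floor (x * fromℕ l)))
      near-x : Near 1 (x * fromℕ l + fromℕ n - fromℕ m)
      near-x = proj₂ (proj₂ (near-floor (x * fromℕ l)))
      vw = *-pos (^-pos N (Q .positive)) (w^-pos l)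
      wb = *-pos (w^-pos k) (b^-pos (n ℕ.+ j))
      diff : (x * y * fromℕ N + fromℕ j - fromℕ i) + (x * fromℕ l + fromℕ n - fromℕ m)
               + - (x * (y * fromℕ N + fromℕ l - fromℕ k))
             ≈ x * fromℕ k + fromℕ (n ℕ.+ j) - fromℕ (m ℕ.+ i)
      diff = ≈-trans
        (solve 9 (λ x y N i j k l m n → (x :* y :* N :+ j :- i) :+ (x :* l :+ n :- m) :+ :-
            (x :* (y :* N :+ l :- k))
                  := x :* k :+ (n :+ j) :- (m :+ i)) ≈-refl
          x y (fromℕ N) (fromℕ i) (fromℕ j) (fromℕ k) (fromℕ l) (fromℕ m) (fromℕ n))
        (≈-sym (+-cong (+-congˡ (fromℕ-+ n j)) (-‿cong (fromℕ-+ m i))))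
      left : (v ^ N * w ^ l) * b ^ m * (w ^ k * b ^ (n ℕ.+ j))
             ≈ v ^ N * b ^ j * ((w ^ k * w ^ l) * (b ^ m * b ^ n))
      left = ≈-trans (*-congˡ (*-congˡ (^-homo-* b n j)))
        (solve 6 (λ v wl wk bm bn bj → (v :* wl) :* bm :* (wk :* (bn :* bj)) := v :* bj :*
            ((wk :* wl) :* (bm :* bn))) ≈-refl
          (v ^ N) (w ^ l) (w ^ k) (b ^ m) (b ^ n) (b ^ j))
      right : w ^ k * (w ^ l * b ^ n) * b ^ (m ℕ.+ i) ≈ b ^ i * ((w ^ k * w ^ l) * (b ^ m * b ^ n))
      right = ≈-trans (*-congˡ (^-homo-* b m i))
        (solve 5 (λ wl wk bm bn bi → wk :* (wl :* bn) :* (bm :* bi) := bi :* ((wk :* wl) :* (bm :* bn))) ≈-refl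
          (w ^ l) (w ^ k) (b ^ m) (b ^ n) (b ^ i))

  -- The condition on `w ^ n` at `N` is the condition on `w` at `n N`.
  isPow-^ : ∀ {b x w} n → IsPow b x w → IsPow b (x * fromℕ n) (w ^ n)
  isPow-^ n P .positive = ^-pos n (P .positive)
  isPow-^ {b} {x} {w} n P .bounds C = let (B , sim) = P .bounds C in B , λ N i j near →
    sim-cong (*-congʳ (≈-sym (^-assocʳ w n N))) ≈-refl (sim (n ℕ.* N) i j
      (near-cong (+-congʳ (+-congʳ (≈-trans (*-assoc _ _ _) (*-congˡ (≈-sym (fromℕ-* n N)))))) near))

  ^-⁻¹-inverse : ∀ {w} N → 0# < w → w ^ N * (w ⁻¹) ^ N ≈ 1#
  ^-⁻¹-inverse {w} N 0<w = ≈-trans (≈-sym (^-distrib-* w (w ⁻¹) N))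
      (≈-trans (^-congˡ N (*-inverseʳ 0<w)) (1^n≈1 N))

  -- Negating the exponent exchanges `i` and `j`; scaling by the N-th power of `w ⁻¹` moves that of
  -- `w` to the other side.
  isPow-⁻¹-exponent : ∀ {b x w} → IsPow b x w → IsPow b (- x) (w ⁻¹)
  isPow-⁻¹-exponent P .positive = ⁻¹-pos (P .positive)
  isPow-⁻¹-exponent {b} {x} {w} P .bounds C = let (B , sim) = P .bounds C in B , λ N i j near →
    sim-sym (sim-cong
      (≈-trans (solve 3 (λ w b v → w :* b :* v := (w :* v) :* b) ≈-refl (w ^ N) (b ^ i) ((w ⁻¹) ^ N))
        (≈-trans (*-congʳ (^-⁻¹-inverse N (P .positive))) (*-identityˡ _)))
      (*-comm _ _)
      (sim-scale (<⇒≤ (^-pos N (⁻¹-pos (P .positive)))) (sim N j i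
        (near-cong (solve 4 (λ x n i j → :- ((:- x) :* n :+ j :- i) := x :* n :+ i :- j)
            ≈-refl x (fromℕ N) (fromℕ i) (fromℕ j))
          (near-neg near)))))

  -- Here `i` and `j` stay. Dividing the comparison by the product of its two sides inverts and
  -- exchanges them, and `Sim` is symmetric.
  isPow-⁻¹-base : ∀ {b x w} → 0# < b → IsPow b x w → IsPow (b ⁻¹) x (w ⁻¹)
  isPow-⁻¹-base 0<b P .positive = ⁻¹-pos (P .positive)
  isPow-⁻¹-base {b} {x} {w} 0<b P .bounds C = let (B , sim) = P .bounds C in B , λ N i j near →
    let W = w ^ N ; W′ = (w ⁻¹) ^ N ; J = b ^ j ; J′ = (b ⁻¹) ^ j ; I = b ^ i ; I′ = (b ⁻¹) ^ i
        WW′ = ^-⁻¹-inverse N (P .positive) ; JJ′ = ^-⁻¹-inverse j 0<b ; II′ = ^-⁻¹-inverse i 0<b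
    in sim-sym (sim-cong
      (≈-trans (solve 5 (λ w w′ j j′ i′ → w :* j :* (w′ :* j′ :* i′) := (w :* w′) :* (j :* j′) :* i′)
          ≈-refl W W′ J J′ I′)
        (≈-trans (*-congʳ (≈-trans (*-cong WW′ JJ′) (*-identityˡ 1#))) (*-identityˡ _)))
      (≈-trans (solve 3 (λ i x i′ → i :* (x :* i′) := (i :* i′) :* x) ≈-refl I (W′ * J′) I′)
        (≈-trans (*-congʳ II′) (*-identityˡ _)))
      (sim-scale (<⇒≤ (*-pos (*-pos (^-pos N (⁻¹-pos (P .positive))) (^-pos j (⁻¹-pos 0<b)))
          (^-pos i (⁻¹-pos 0<b))))
        (sim N i j near)))

-- The supremum that defines real powers meets the characterisation.

module PowerFunction (ℝ : RealField) where

  open RealField ℝ hiding (refl; sym; trans; zero)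
  open Analysis ℝ using (_^_; _/_; fromℕ; PowersBelow; _^ʳ_)
  open OrderedField ℝ
  open Powers ℝ
  open IsPow

  ⁻¹-involutive : ∀ {x} → 0# < x → x ⁻¹ ⁻¹ ≈ x
  ⁻¹-involutive {x} 0<x = begin
    x ⁻¹ ⁻¹               ≈⟨ *-identityˡ _ ⟨
    1# * x ⁻¹ ⁻¹          ≈⟨ *-congʳ (*-inverseʳ 0<x) ⟨
    x * x ⁻¹ * x ⁻¹ ⁻¹    ≈⟨ *-assoc _ _ _ ⟩
    x * (x ⁻¹ * x ⁻¹ ⁻¹)  ≈⟨ *-congˡ (*-inverseʳ (⁻¹-pos 0<x)) ⟩
    x * 1#                ≈⟨ *-identityʳ x ⟩
    x                     ∎
    where open import Relation.Binary.Reasoning.Setoid setoid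

  -- Together with `powersBelow-elim` this trades the integer exponent of the definition for a
  -- difference `i - j` of natural numbers, the form used by `IsPow`.
  powersBelow-intro : ∀ {b x y} i j n → 0# < b → 0# < y → 1 ℕ.≤ n →
                      fromℕ i ≤ x * fromℕ n + fromℕ j → y ^ n * b ^ j ≤ b ^ i → y ∈ PowersBelow b x
  powersBelow-intro {b} {x} {y} i j n 0<b 0<y 1≤n i≤xn+j yⁿbʲ≤bⁱ with ℕ.≤-total j i
  ... | inj₁ j≤i = 0<y , ℤ.+ d , n , 1≤n ,
    +-cancelʳ-≤ (fromℕ j) (≤-respˡ-≈ (≈-trans (reflexive (≡.cong fromℕ (≡.sym d+j≡i))) (fromℕ-+ d j)) i≤xn+j) ,
    *-cancelʳ-≤ (^-pos j 0<b) (≤-respʳ-≈ (≈-trans (^-congʳ b (≡.sym d+j≡i)) (^-homo-* b d j)) yⁿbʲ≤bⁱ)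
    where
    d     = i ℕ.∸ j
    d+j≡i = ℕ.m∸n+n≡m j≤i
  ... | inj₂ i≤j with j ℕ.∸ i | ℕ.m∸n+n≡m i≤j
  -- The case `i ≡ j` needs its own clause: `ℤ.-[1+ d ]` starts at -1.
  ... | zero  | ≡.refl = 0<y , ℤ.+ 0 , n , 1≤n ,
    +-cancelʳ-≤ (fromℕ i) (≤-respˡ-≈ (≈-sym (+-identityˡ _)) i≤xn+j) ,
    *-cancelʳ-≤ (^-pos i 0<b) (≤-respʳ-≈ (≈-sym (*-identityˡ _)) yⁿbʲ≤bⁱ)
  ... | suc d | ≡.refl = 0<y , ℤ.-[1+ d ] , n , 1≤n ,
    ≤-by (x≤y⇒0≤y-x i≤xn+j) (≈-trans (+-congˡ (+-congʳ (+-congˡ (fromℕ-+ (suc d) i))))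
      (solve 3 (λ x d i → :- d :+ ((x :+ (d :+ i)) :- i) := x)
          ≈-refl (x * fromℕ n) (fromℕ (suc d)) (fromℕ i))) ,
    *-cancelʳ-≤ (^-pos (suc d) 0<b) (*-cancelʳ-≤ (^-pos i 0<b) (≤-resp₂-≈
      (≈-trans (*-congˡ (^-homo-* b (suc d) i)) (≈-sym (*-assoc _ _ _)))
      (≈-sym (≈-trans (*-congʳ (*-inverseˡ (^-pos (suc d) 0<b))) (*-identityˡ _))) yⁿbʲ≤bⁱ))

  powersBelow-elim : ∀ {b x y} → 0# < b → y ∈ PowersBelow b x → 0# < y × ∃[ i ] ∃[ j ] ∃[ n ]
                     1 ℕ.≤ n × fromℕ i ≤ x * fromℕ n + fromℕ j × y ^ n * b ^ j ≤ b ^ i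
  powersBelow-elim {b} {x} {y} 0<b (0<y , ℤ.+ k , n , 1≤n , k≤xn , yⁿ≤bᵏ) = 0<y , k , 0 , n , 1≤n ,
    ≤-respʳ-≈ (≈-sym (+-identityʳ _)) k≤xn , ≤-respˡ-≈ (≈-sym (*-identityʳ _)) yⁿ≤bᵏ
  powersBelow-elim {b} {x} {y} 0<b (0<y , ℤ.-[1+ k ] , n , 1≤n , -k≤xn , yⁿ≤b⁻ᵏ) = 0<y , 0 , suc k , n , 1≤n ,
    ≤-by (x≤y⇒0≤y-x -k≤xn) (solve 2 (λ x k → :0 :+ (x :- (:- k)) := x :+ k)
        ≈-refl (x * fromℕ n) (fromℕ (suc k))) ,
    ≤-respʳ-≈ (*-inverseˡ (^-pos (suc k) 0<b)) (*-monoʳ-≤ (<⇒≤ (^-pos (suc k) 0<b)) yⁿ≤b⁻ᵏ)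

  private
    variable
      b x y : Carrier

  1≤⇒0< : 1# ≤ b → 0# < b
  1≤⇒0< = <-≤-trans 0<1

  -- Replaces the exponent `i - j` by a natural number `k` above it, powers of `b ≥ 1` being
  -- monotone.
  ^-cancelʳ-factor : ∀ {b y} i j k → 0# < b → 0# ≤ y → y * b ^ j ≤ b ^ i → i ℕ.≤ j ℕ.+ k → 1# ≤ b → y ≤ b ^ k
  ^-cancelʳ-factor {b} {y} i j k 0<b 0≤y p i≤j+k 1≤b = *-cancelʳ-≤ (^-pos j 0<b) (begin
    y * b ^ j       ≤⟨ p ⟩
    b ^ i           ≤⟨ ^-monoʳ-≤ 1≤b i≤j+k ⟩
    b ^ (j ℕ.+ k)   ≈⟨ ^-homo-* b j k ⟩
    b ^ j * b ^ k   ≈⟨ *-comm _ _ ⟩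
    b ^ k * b ^ j   ∎)
    where open ≤-Reasoning

  -- Membership of `y` gives `y^n ≤ b^(k-l)` with `k - l ≤ x n`, and `x N ≤ i - j`. Hence
  -- `(k - l) N ≤ (i - j) n`, which compares the n-th powers of the two sides; n-th roots are
  -- monotone.
  powersBelow-bound : 1# ≤ b → y ∈ PowersBelow b x → ∀ N i j → x * fromℕ N + fromℕ j ≤ fromℕ i → y ^ N * b ^ j ≤ b ^ i
  powersBelow-bound {b} {y} {x} 1≤b y∈ N i j xN+j≤i =
    let 0<b = 1≤⇒0< 1≤b
        (0<y , k , l , n , 1≤n , k≤xn+l , yⁿbˡ≤bᵏ) = powersBelow-elim 0<b y∈
        exponents : k ℕ.* N ℕ.+ j ℕ.* n ℕ.≤ l ℕ.* N ℕ.+ i ℕ.* n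
        exponents = fromℕ-cancel-≤ (≤-resp₂-≈
          (≈-sym (≈-trans (fromℕ-+ (k ℕ.* N) (j ℕ.* n)) (+-cong (fromℕ-* k N) (fromℕ-* j n))))
          (≈-sym (≈-trans (fromℕ-+ (l ℕ.* N) (i ℕ.* n)) (+-cong (fromℕ-* l N) (fromℕ-* i n))))
          (≤-by (+-nonNeg (*-nonNeg (x≤y⇒0≤y-x k≤xn+l) (fromℕ-nonNeg N))
              (*-nonNeg (x≤y⇒0≤y-x xN+j≤i) (fromℕ-nonNeg n)))
            (solve 7 (λ x N n i j k l → (k :* N :+ j :* n) :+
                (((x :* n :+ l) :- k) :* N :+ (i :- (x :* N :+ j)) :* n)
                                         := l :* N :+ i :* n) ≈-refl
              x (fromℕ N) (fromℕ n) (fromℕ i) (fromℕ j) (fromℕ k) (fromℕ l))))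
        0≤yᴺ = ^-nonNeg N (<⇒≤ 0<y)
    in ^-cancel-≤ n 1≤n (^-nonNeg i (<⇒≤ 0<b)) (≤-respʳ-≈ (≈-sym (^-assocʳ b i n))
        (^-cancelʳ-factor (k ℕ.* N ℕ.+ j ℕ.* n) (l ℕ.* N) (i ℕ.* n) 0<b
            (^-nonNeg n (*-nonNeg 0≤yᴺ (^-nonNeg j (<⇒≤ 0<b))))
          (begin
            (y ^ N * b ^ j) ^ n * b ^ (l ℕ.* N)
              ≈⟨ *-cong (≈-trans (^-distrib-* (y ^ N) (b ^ j) n)
                   (*-cong (≈-trans (^-assocʳ y N n)
                       (≈-trans (^-congʳ y (ℕ.*-comm N n)) (≈-sym (^-assocʳ y n N)))) (^-assocʳ b j n)))
                   (≈-sym (^-assocʳ b l N)) ⟩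
            (y ^ n) ^ N * b ^ (j ℕ.* n) * (b ^ l) ^ N
              ≈⟨ solve 3 (λ y j l → y :* j :* l := (y :* l) :* j)
                  ≈-refl ((y ^ n) ^ N) (b ^ (j ℕ.* n)) ((b ^ l) ^ N) ⟩
            (y ^ n) ^ N * (b ^ l) ^ N * b ^ (j ℕ.* n)
              ≈⟨ *-congʳ (^-distrib-* (y ^ n) (b ^ l) N) ⟨
            (y ^ n * b ^ l) ^ N * b ^ (j ℕ.* n)
              ≤⟨ *-monoʳ-≤ (^-nonNeg (j ℕ.* n) (<⇒≤ 0<b))
                  (^-mono-≤ N (*-nonNeg (^-nonNeg n (<⇒≤ 0<y)) (^-nonNeg l (<⇒≤ 0<b))) yⁿbˡ≤bᵏ) ⟩
            (b ^ k) ^ N * b ^ (j ℕ.* n)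
              ≈⟨ *-congʳ (^-assocʳ b k N) ⟩
            b ^ (k ℕ.* N) * b ^ (j ℕ.* n)
              ≈⟨ ^-homo-* b (k ℕ.* N) (j ℕ.* n) ⟨
            b ^ (k ℕ.* N ℕ.+ j ℕ.* n) ∎)
          exponents 1≤b))
    where open ≤-Reasoning

  powersBelow-inhabited : 1# ≤ b → ∀ x → Satisfiable (PowersBelow b x)
  powersBelow-inhabited {b} 1≤b x = (b ^ j) ⁻¹ , powersBelow-intro 0 j 1 0<b (⁻¹-pos (^-pos j 0<b)) ℕ.≤-refl
    (≤-by (x≤y⇒0≤y-x -x≤j) (solve 2 (λ x j → :0 :+ (j :- (:- x)) := x :* (:1 :+ :0) :+ j) ≈-refl x (fromℕ j)))
    (≤-reflexive (≈-trans (*-congʳ (*-identityʳ _)) (*-inverseˡ (^-pos j 0<b))))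
    where
    0<b  = 1≤⇒0< 1≤b
    j    = proj₁ (archimedean (- x))
    -x≤j = proj₂ (archimedean (- x))

  powersBelow-isSup : 1# ≤ b → ∀ x → IsSup (PowersBelow b x) (sup (PowersBelow b x))
  powersBelow-isSup {b} 1≤b x = let (M , x≤M) = archimedean x in complete (powersBelow-inhabited 1≤b x)
    (b ^ M , λ {y} y∈ → ≤-respˡ-≈ (solve 1 (λ y → y :* :1 :* :1 := y) ≈-refl y)
      (powersBelow-bound 1≤b y∈ 1 M 0 (≤-respˡ-≈ (solve 1 (λ x → x := x :* (:1 :+ :0) :+ :0) ≈-refl x) x≤M)))

  -- By Bernoulli, 1 - 1/(2N) will do.
  almost-one : ∀ N → 1 ℕ.≤ N → ∃[ c ] 0# < c × c < 1# × 1# ≤ (1# + 1#) * c ^ N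
  almost-one N 1≤N = 1# - h ,
    <-≤-trans (*-pos (fromℕ-pos 1≤N) 0<h) (≤-by (x≤y⇒0≤y-x h≤Nh)
      (≈-trans (solve 2 (λ N h → N :* h :+ (N :* h :- h) := (N :+ N) :* h :- h)
          ≈-refl (fromℕ N) h) (+-congʳ Nh+Nh≈1))) ,
    0<y-x⇒x<y (<-respʳ-≈ (solve 1 (λ h → h := :1 :- (:1 :- h)) ≈-refl h) 0<h) ,
    (begin
      1#                               ≈⟨ solve 1 (λ x → :1 := :2 :- x :+ (x :- :1)) ≈-refl _ ⟩
      2# - 2N * h + (2N * h - 1#)      ≈⟨ +-congˡ (≈-trans (+-congʳ Nh+Nh≈1) (-‿inverseʳ 1#)) ⟩
      2# - 2N * h + 0#
        ≈⟨ solve 2 (λ N h → :2 :- (N :+ N) :* h :+ :0 := (:1 :+ :1) :* (:1 :- N :* h)) ≈-refl (fromℕ N) h ⟩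
      2# * (1# - fromℕ N * h)          ≤⟨ *-monoˡ-≤ (+-nonNeg 0≤1 0≤1) (bernoulli⁻ N (<⇒≤ 0<h) h≤1) ⟩
      2# * (1# - h) ^ N                ∎)
    where
    open ≤-Reasoning
    2# = 1# + 1#
    2N = fromℕ N + fromℕ N
    0<2N : 0# < 2N
    0<2N = +-pos-nonNeg (fromℕ-pos 1≤N) (fromℕ-nonNeg N)
    h = 2N ⁻¹
    0<h = ⁻¹-pos 0<2N
    Nh+Nh≈1 : 2N * h ≈ 1#
    Nh+Nh≈1 = *-inverseʳ 0<2N
    h≤Nh : h ≤ fromℕ N * h
    h≤Nh = ≤-respˡ-≈ (solve 1 (λ h → (:1 :+ :0) :* h := h) ≈-refl h) (*-monoʳ-≤ (<⇒≤ 0<h) (fromℕ-mono-≤ 1≤N))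
    h≤1 : h ≤ 1#
    h≤1 = ≤-trans h≤Nh (≤-by (*-nonNeg (fromℕ-nonNeg N) (<⇒≤ 0<h))
        (≈-trans (≈-sym (distribʳ h (fromℕ N) (fromℕ N))) Nh+Nh≈1))

  near⇒≤ : ∀ {C} i j → Near C (x + fromℕ j - fromℕ i) → x + fromℕ j ≤ fromℕ (i ℕ.+ C)
  near⇒≤ {x} {C} i j near = ≤-respʳ-≈ (≈-sym (fromℕ-+ i C)) (≤-by (x≤y⇒0≤y-x (Near.upper near))
    (solve 4 (λ x i j c → (x :+ j) :+ (c :- (x :+ j :- i)) := i :+ c) ≈-refl x (fromℕ i) (fromℕ j) (fromℕ C)))

  near⇒≥ : ∀ {C} i j → Near C (x + fromℕ j - fromℕ i) → fromℕ i ≤ x + fromℕ (j ℕ.+ C)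
  near⇒≥ {x} {C} i j near = ≤-respʳ-≈ (+-congˡ (≈-sym (fromℕ-+ j C))) (≤-by (x≤y⇒0≤y-x (Near.lower near))
    (solve 4 (λ x i j c → i :+ ((x :+ j :- i) :- (:- c)) := x :+ (j :+ c))
        ≈-refl x (fromℕ i) (fromℕ j) (fromℕ C)))

  -- Some element of the set exceeds `w * c`, and `w / c` is too large to belong to it; testing both
  -- against the exponent `i - j` bounds `w ^ N` from above and below. The constant 2 pays for
  -- `c ^ N`, and `b ^ C` for the distance of `i - j` from `x N`.
  sup-isPow : 1# ≤ b → ∀ x → IsPow b x (sup (PowersBelow b x))
  sup-isPow {b} 1≤b x = record { positive = 0<w ; bounds = λ C → 2# * b ^ C , sim C }
    where
    open ≤-Reasoning
    2#  = 1# + 1#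
    0≤2 = +-nonNeg 0≤1 0≤1
    0<b = 1≤⇒0< 1≤b
    w = sup (PowersBelow b x)
    isSup = powersBelow-isSup 1≤b x
    0<w : 0# < w
    0<w = let (y , y∈) = powersBelow-inhabited 1≤b x in <-≤-trans (proj₁ y∈) (IsSupremum.upper isSup y∈)
    b^-≤ : ∀ {C i j} → j ℕ.≤ i ℕ.+ C → b ^ j ≤ 2# * b ^ C * b ^ i
    b^-≤ {C} {i} {j} j≤i+C = begin
      b ^ j                   ≤⟨ ^-monoʳ-≤ 1≤b j≤i+C ⟩
      b ^ (i ℕ.+ C)           ≈⟨ ^-homo-* b i C ⟩
      b ^ i * b ^ C           ≤⟨ ≤-by (<⇒≤ (*-pos (^-pos i 0<b) (^-pos C 0<b)))
                                   (solve 2 (λ i c → i :* c :+ i :* c := (:1 :+ :1) :* c :* i)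
                                       ≈-refl (b ^ i) (b ^ C)) ⟩
      2# * b ^ C * b ^ i      ∎
    sim : ∀ C N i j → Near C (x * fromℕ N + fromℕ j - fromℕ i) → Sim (2# * b ^ C) (w ^ N * b ^ j) (b ^ i)
    -- `almost-one` requires `N ≥ 1`; at 0 the hypothesis only says that `i` and `j` differ by at
    -- most `C`.
    sim C zero i j near = sim-cong (≈-sym (*-identityˡ _)) ≈-refl
      ( b^-≤ {i = i} {j} (fromℕ-cancel-≤ (≤-respˡ-≈ (x*0+y≈y (fromℕ j)) (near⇒≤ i j near)))
      , b^-≤ {i = j} {i} (fromℕ-cancel-≤ (≤-respʳ-≈ (x*0+y≈y (fromℕ (j ℕ.+ C))) (near⇒≥ i j near))))
      where
      x*0+y≈y : ∀ y → x * 0# + y ≈ y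
      x*0+y≈y = solve 2 (λ x y → x :* :0 :+ y := y) ≈-refl x
    sim C N@(suc _) i j near = upper , lower
      where
      N⁺ : 1 ℕ.≤ N
      N⁺ = s≤s z≤n
      c     = proj₁ (almost-one N N⁺)
      0<c   = proj₁ (proj₂ (almost-one N N⁺))
      c<1   = proj₁ (proj₂ (proj₂ (almost-one N N⁺)))
      1≤2cᴺ = proj₂ (proj₂ (proj₂ (almost-one N N⁺)))
      *c-< : ∀ {y} → 0# < y → y * c < y
      *c-< {y} 0<y = <-respˡ-≈ (*-comm c y) (<-respʳ-≈ (*-identityˡ y) (*-monoʳ-< 0<y c<1))
      upper : w ^ N * b ^ j ≤ 2# * b ^ C * b ^ i
      upper = let (y , y∈ , wc<y) = IsSupremum.least isSup (*c-< 0<w) in begin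
        w ^ N * b ^ j                     ≈⟨ *-identityˡ _ ⟨
        1# * (w ^ N * b ^ j)              ≤⟨ *-monoʳ-≤ (<⇒≤ (*-pos (^-pos N 0<w) (^-pos j 0<b))) 1≤2cᴺ ⟩
        2# * c ^ N * (w ^ N * b ^ j)
          ≈⟨ solve 4 (λ t c w b → t :* c :* (w :* b) := t :* ((w :* c) :* b))
              ≈-refl 2# (c ^ N) (w ^ N) (b ^ j) ⟩
        2# * (w ^ N * c ^ N * b ^ j)      ≈⟨ *-congˡ (*-congʳ (^-distrib-* w c N)) ⟨
        2# * ((w * c) ^ N * b ^ j)
          ≤⟨ *-monoˡ-≤ 0≤2 (*-monoʳ-≤ (^-nonNeg j (<⇒≤ 0<b)) (^-mono-≤ N (<⇒≤ (*-pos 0<w 0<c)) (<⇒≤ wc<y))) ⟩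
        2# * (y ^ N * b ^ j)
          ≤⟨ *-monoˡ-≤ 0≤2 (powersBelow-bound 1≤b y∈ N (i ℕ.+ C) j (near⇒≤ i j near)) ⟩
        2# * b ^ (i ℕ.+ C)                ≈⟨ *-congˡ (≈-trans (^-homo-* b i C) (*-comm _ _)) ⟩
        2# * (b ^ C * b ^ i)              ≈⟨ *-assoc _ _ _ ⟨
        2# * b ^ C * b ^ i                ∎
      v = w / c
      0<v = *-pos 0<w (⁻¹-pos 0<c)
      vc≈w : v * c ≈ w
      vc≈w = *-/-cancel 0<c
      bⁱ≤ : b ^ i ≤ v ^ N * b ^ (j ℕ.+ C)
      -- Otherwise `v` lies below the power with exponent `(i - j - C) / N ≤ x`, so it belongs to
      -- the set and `v ≤ w`, although `w = v * c < v`.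
      bⁱ≤ = ≮⇒≥ λ vᴺbʲ⁺ᶜ<bⁱ → <⇒≱ (<-respˡ-≈ vc≈w (*c-< 0<v)) (IsSupremum.upper isSup
        (powersBelow-intro i (j ℕ.+ C) N 0<b 0<v N⁺ (near⇒≥ i j near) (<⇒≤ vᴺbʲ⁺ᶜ<bⁱ)))
      lower : b ^ i ≤ 2# * b ^ C * (w ^ N * b ^ j)
      lower = begin
        b ^ i                                     ≈⟨ *-identityˡ _ ⟨
        1# * b ^ i                                ≤⟨ *-monoʳ-≤ (^-nonNeg i (<⇒≤ 0<b)) 1≤2cᴺ ⟩
        2# * c ^ N * b ^ i                        ≤⟨ *-monoˡ-≤ (*-nonNeg 0≤2 (^-nonNeg N (<⇒≤ 0<c))) bⁱ≤ ⟩
        2# * c ^ N * (v ^ N * b ^ (j ℕ.+ C))      ≈⟨ *-congˡ (*-congˡ (^-homo-* b j C)) ⟩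
        2# * c ^ N * (v ^ N * (b ^ j * b ^ C))
          ≈⟨ solve 5 (λ t c v j C → t :* c :* (v :* (j :* C)) := t :* C :* (v :* c :* j))
              ≈-refl 2# (c ^ N) (v ^ N) (b ^ j) (b ^ C) ⟩
        2# * b ^ C * (v ^ N * c ^ N * b ^ j)
          ≈⟨ *-congˡ (*-congʳ (≈-trans (≈-sym (^-distrib-* v c N)) (^-congˡ N vc≈w))) ⟩
        2# * b ^ C * (w ^ N * b ^ j)              ∎

  ^ʳ-isSup : 1# ≤ b → ∀ x → IsSup (PowersBelow b x) (b ^ʳ x)
  ^ʳ-isSup {b} 1≤b x with 1# ≤? b
  ... | yes _   = powersBelow-isSup 1≤b x
  ... | no  1≰b = contradiction 1≤b 1≰b

  1≤x⁻¹ : x < 1# → 0# < x → 1# ≤ x ⁻¹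
  1≤x⁻¹ x<1 0<x = ≤-resp₂-≈ (*-inverseʳ 0<x) (*-identityˡ _) (*-monoʳ-≤ (<⇒≤ (⁻¹-pos 0<x)) (<⇒≤ x<1))

  -- For `b` below 1 the value is the power of `b ⁻¹` with exponent `- x`; inverting base and
  -- exponent inverts it twice. The power laws can then ignore the case distinction at 1.
  ^ʳ-isPow : 0# < b → ∀ x → IsPow b x (b ^ʳ x)
  ^ʳ-isPow {b} 0<b x with 1# ≤? b
  ... | yes 1≤b = sup-isPow 1≤b x
  ... | no  1≰b = let P = sup-isPow (1≤x⁻¹ (≰⇒> 1≰b) 0<b) (- x) in
    isPow-cong (⁻¹-involutive 0<b) (solve 1 (λ x → :- (:- x) := x) ≈-refl x) (⁻¹-involutive (P .positive))
      (isPow-⁻¹-exponent (isPow-⁻¹-base (⁻¹-pos 0<b) P))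

  ^ʳ-pos : 0# < b → ∀ x → 0# < b ^ʳ x
  ^ʳ-pos 0<b x = ^ʳ-isPow 0<b x .positive

  ^≤^ʳ : ∀ {b x} k → 1# ≤ b → fromℕ k ≤ x → b ^ k ≤ b ^ʳ x
  ^≤^ʳ {b} {x} k 1≤b k≤x = IsSupremum.upper (^ʳ-isSup 1≤b x)
    (powersBelow-intro k 0 1 (1≤⇒0< 1≤b) (^-pos k (1≤⇒0< 1≤b)) ℕ.≤-refl
      (≤-respʳ-≈ (solve 1 (λ x → x := x :* (:1 :+ :0) :+ :0) ≈-refl x) k≤x)
      (≤-reflexive (solve 1 (λ y → y :* :1 :* :1 := y) ≈-refl (b ^ k))))

-- The series for `e` and the inequality `e^u (1 - u) ≤ 1`.

module Exponential (ℝ : RealField) where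

  open RealField ℝ hiding (refl; sym; trans; zero)
  open Analysis ℝ using (_^_; fromℕ; sum; PartialSums; e; PowersBelow; _^ʳ_)
  open OrderedField ℝ
  open Powers ℝ
  open PowerFunction ℝ
  open ≤-Reasoning

  sum-snoc : ∀ (a : ℕ → Carrier) k → sum {suc k} (a ∘ toℕ) ≈ sum {k} (a ∘ toℕ) + a k
  sum-snoc a zero    = +-comm _ _
  sum-snoc a (suc k) = ≈-trans (+-congˡ (sum-snoc (a ∘ suc) k)) (≈-sym (+-assoc _ _ _))

  1/! : ℕ → Carrier
  1/! k = fromℕ (k !) ⁻¹

  fromℕ-!-pos : ∀ k → 0# < fromℕ (k !)
  fromℕ-!-pos k = fromℕ-pos (ℕ.1≤n! k)

  1/!-nonNeg : ∀ k → 0# ≤ 1/! k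
  1/!-nonNeg k = <⇒≤ (⁻¹-pos (fromℕ-!-pos k))

  1/!-suc : ∀ k → fromℕ (suc k) * 1/! (suc k) ≈ 1/! k
  1/!-suc k = begin-equality
    s * t                 ≈⟨ *-identityʳ _ ⟨
    s * t * 1#            ≈⟨ *-congˡ (*-inverseʳ (fromℕ-!-pos k)) ⟨
    s * t * (f * f ⁻¹)
      ≈⟨ solve 4 (λ s t f g → s :* t :* (f :* g) := (s :* f) :* t :* g) ≈-refl s t f (f ⁻¹) ⟩
    s * f * t * f ⁻¹      ≈⟨ *-congʳ (*-congʳ (fromℕ-* (suc k) (k !))) ⟨
    fromℕ (suc k !) * t * f ⁻¹ ≈⟨ *-congʳ (*-inverseʳ (fromℕ-!-pos (suc k))) ⟩
    1# * f ⁻¹             ≈⟨ *-identityˡ _ ⟩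
    f ⁻¹                  ∎
    where
    s = fromℕ (suc k)
    t = 1/! (suc k)
    f = fromℕ (k !)

  1/!-0 : 1/! 0 ≈ 1#
  1/!-0 = ≈-trans (≈-sym (*-identityˡ _)) (≈-trans (*-congʳ (≈-sym fromℕ-1)) (*-inverseʳ (fromℕ-!-pos 0)))

  -- The first `k` terms of the exponential series at `u`. The argument varies because the value at
  -- 1, a partial sum for `e`, is estimated by moving there from 0.
  expSum : ℕ → Carrier → Carrier
  expSum zero    u = 0#
  expSum (suc k) u = expSum k u + 1/! k * u ^ k

  expSum-cong : ∀ k {u v} → u ≈ v → expSum k u ≈ expSum k v
  expSum-cong zero    u≈v = ≈-refl
  expSum-cong (suc k) u≈v = +-cong (expSum-cong k u≈v) (*-congˡ (^-congˡ k u≈v))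

  expSum-1 : ∀ k → expSum k 1# ≈ sum {k} (1/! ∘ toℕ)
  expSum-1 zero    = ≈-refl
  expSum-1 (suc k) = ≈-sym (≈-trans (sum-snoc 1/! k)
    (+-cong (≈-sym (expSum-1 k)) (≈-trans (≈-sym (*-identityʳ _)) (*-congˡ (≈-sym (1^n≈1 k))))))

  expSum-0 : ∀ k → expSum k 0# ≤ 1#
  expSum-0 zero          = 0≤1
  expSum-0 (suc zero)    = ≤-reflexive (≈-trans (+-identityˡ _) (≈-trans (*-identityʳ _) 1/!-0))
  expSum-0 (suc (suc k)) = ≤-respˡ-≈
    (solve 3 (λ s f t → s := s :+ f :* (:0 :* t))
        ≈-refl (expSum (suc k) 0#) (1/! (suc k)) (0# ^ k)) (expSum-0 (suc k))

  -- The mean value estimate for powers, with the derivative taken at the right end point.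
  ^-increment : ∀ {a y} k → 0# ≤ a → 0# ≤ y →
                (a + y) ^ suc k ≤ a ^ suc k + fromℕ (suc k) * (y * (a + y) ^ k)
  ^-increment {a} {y} zero 0≤a 0≤y = ≤-reflexive
    (solve 2 (λ a y → (a :+ y) :* :1 := a :* :1 :+ (:1 :+ :0) :* (y :* :1)) ≈-refl a y)
  ^-increment {a} {y} (suc k) 0≤a 0≤y = begin
    (a + y) * s ^ suc k
      ≈⟨ distribʳ _ _ _ ⟩
    a * s ^ suc k + y * s ^ suc k
      ≤⟨ +-monoˡ-≤ _ (*-monoˡ-≤ 0≤a (^-increment k 0≤a 0≤y)) ⟩
    a * (a ^ suc k + n * (y * s ^ k)) + y * s ^ suc k
      ≤⟨ ≤-by (*-nonNeg (fromℕ-nonNeg (suc k)) (*-nonNeg 0≤y (*-nonNeg 0≤y (^-nonNeg k 0≤s))))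
         (solve 5 (λ a y A n S → (a :* (A :+ n :* (y :* S)) :+ y :* ((a :+ y) :* S)) :+ n :* (y :* (y :* S))
            := a :* A :+ (:1 :+ n) :* (y :* ((a :+ y) :* S))) ≈-refl a y (a ^ suc k) n (s ^ k)) ⟩
    a * a ^ suc k + fromℕ (suc (suc k)) * (y * s ^ suc k) ∎
    where
    s = a + y
    n = fromℕ (suc k)
    0≤s = +-nonNeg 0≤a 0≤y

  -- The same estimate term by term: the derivative of a truncation is the truncation one term
  -- shorter, by `1/!-suc`.
  expSum-increment : ∀ {a y} k → 0# ≤ a → 0# ≤ y →
                     expSum (suc k) (a + y) ≤ expSum (suc k) a + y * expSum k (a + y)
  expSum-increment {a} {y} zero 0≤a 0≤y = ≤-reflexive
    (solve 2 (λ f y → f := f :+ y :* :0) ≈-refl (expSum 1 a) y)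
  expSum-increment {a} {y} (suc k) 0≤a 0≤y = begin
    expSum (suc k) s + f * s ^ suc k
      ≤⟨ +-mono-≤ (expSum-increment k 0≤a 0≤y) (*-monoˡ-≤ (1/!-nonNeg (suc k)) (^-increment k 0≤a 0≤y)) ⟩
    (expSum (suc k) a + y * expSum k s) + f * (a ^ suc k + n * (y * s ^ k))
      ≈⟨ solve 7 (λ A y S f B n T → (A :+ y :* S) :+ f :* (B :+ n :* (y :* T)) := (A :+ f :* B) :+ y :*
          (S :+ (n :* f) :* T)) ≈-refl
           (expSum (suc k) a) y (expSum k s) f (a ^ suc k) n (s ^ k) ⟩
    expSum (suc (suc k)) a + y * (expSum k s + (n * f) * s ^ k)
      ≈⟨ +-congˡ (*-congˡ (+-congˡ (*-congʳ (1/!-suc k)))) ⟩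
    expSum (suc (suc k)) a + y * expSum (suc k) s ∎
    where
    s = a + y
    n = fromℕ (suc k)
    f = 1/! (suc k)

  -- A truncation dominates its derivative, so passing from `a` to `a + y` adds at most
  -- `y * expSum k (a + y)`.
  expSum-step : ∀ {a y} k → 0# ≤ a → 0# ≤ y → (1# - y) * expSum k (a + y) ≤ expSum k a
  expSum-step {a} {y} zero    0≤a 0≤y = ≤-reflexive (zeroʳ _)
  expSum-step {a} {y} (suc k) 0≤a 0≤y = begin
    (1# - y) * (E + t)
      ≤⟨ ≤-by (*-nonNeg 0≤y (*-nonNeg (1/!-nonNeg k) (^-nonNeg k (+-nonNeg 0≤a 0≤y))))
         (solve 3 (λ y E t → (:1 :- y) :* (E :+ t) :+ y :* t := (E :+ t) :- y :* E) ≈-refl y E t) ⟩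
    (E + t) - y * E
      ≤⟨ +-monoˡ-≤ _ (expSum-increment k 0≤a 0≤y) ⟩
    (expSum (suc k) a + y * E) - y * E
      ≈⟨ solve 2 (λ a b → (a :+ b) :- b := a) ≈-refl (expSum (suc k) a) (y * E) ⟩
    expSum (suc k) a ∎
    where
    E = expSum k (a + y)
    t = 1/! k * (a + y) ^ k

  -- `N` steps of length `h`, each costing a factor `1# - h`, lead back to 0, where the truncation
  -- is at most 1.
  expSum-bound : ∀ {h} N k → 0# ≤ h → h ≤ 1# → (1# - h) ^ N * expSum k (fromℕ N * h) ≤ 1#
  expSum-bound {h} zero    k 0≤h h≤1 = ≤-respˡ-≈ (≈-sym (≈-trans (*-identityˡ _) (expSum-cong k (zeroˡ h))))
      (expSum-0 k)
  expSum-bound {h} (suc N) k 0≤h h≤1 = begin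
    (1# - h) * (1# - h) ^ N * expSum k ((1# + fromℕ N) * h)
      ≈⟨ *-congˡ (expSum-cong k (solve 2 (λ n h → (:1 :+ n) :* h := n :* h :+ h) ≈-refl (fromℕ N) h)) ⟩
    (1# - h) * (1# - h) ^ N * expSum k (fromℕ N * h + h)
      ≈⟨ solve 3 (λ a b c → a :* b :* c := b :* (a :* c))
          ≈-refl (1# - h) ((1# - h) ^ N) (expSum k (fromℕ N * h + h)) ⟩
    (1# - h) ^ N * ((1# - h) * expSum k (fromℕ N * h + h))
      ≤⟨ *-monoˡ-≤ (^-nonNeg N (x≤y⇒0≤y-x h≤1)) (expSum-step k (*-nonNeg (fromℕ-nonNeg N) 0≤h) 0≤h) ⟩
    (1# - h) ^ N * expSum k (fromℕ N * h)
      ≤⟨ expSum-bound N k 0≤h h≤1 ⟩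
    1# ∎

  *≤1⇒≤⁻¹ : ∀ {x z} → 0# < z → z * x ≤ 1# → x ≤ z ⁻¹
  *≤1⇒≤⁻¹ 0<z zx≤1 = *-cancelʳ-≤ 0<z (≤-resp₂-≈ (*-comm _ _) (≈-sym (*-inverseˡ 0<z)) zx≤1)

  module _ (N : ℕ) (1≤N : 1 ℕ.≤ N) where
    private
      h = fromℕ N ⁻¹

    1/N-nonNeg : 0# ≤ h
    1/N-nonNeg = <⇒≤ (⁻¹-pos (fromℕ-pos 1≤N))

    1/N≤1 : h ≤ 1#
    1/N≤1 = ≤-resp₂-≈ (*-identityˡ h) (*-inverseʳ (fromℕ-pos 1≤N))
      (*-monoʳ-≤ 1/N-nonNeg (≤-respˡ-≈ fromℕ-1 (fromℕ-mono-≤ 1≤N)))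

    [1-1/N]^N*partialSum≤1 : ∀ {s} → s ∈ PartialSums 1/! → (1# - h) ^ N * s ≤ 1#
    [1-1/N]^N*partialSum≤1 (k , s≈) = ≤-respˡ-≈
      (*-congˡ (≈-trans (expSum-cong k (*-inverseʳ (fromℕ-pos 1≤N))) (≈-trans (expSum-1 k) (≈-sym s≈))))
      (expSum-bound N k 1/N-nonNeg 1/N≤1)

  e-isSup : IsSup (PartialSums 1/!) e
  -- Two is the least `N` for which `1 - 1/N` is positive; it bounds the partial sums by 4.
  e-isSup = complete (0# , 0 , ≈-refl) (((1# - h) ^ 2) ⁻¹ , λ s∈ → *≤1⇒≤⁻¹ (^-pos 2 0<1-h) ([1-1/N]^N*partialSum≤1 2 (s≤s z≤n) s∈))
    where
    h = fromℕ 2 ⁻¹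
    0<h = ⁻¹-pos (fromℕ-suc-pos 1)
    0<1-h : 0# < 1# - h
    0<1-h = <-respʳ-≈ (≈-trans (solve 1 (λ h → h := (:1 :+ (:1 :+ :0)) :* h :- h) ≈-refl h)
      (+-congʳ (*-inverseʳ (fromℕ-suc-pos 1)))) 0<h

  1≤e : 1# ≤ e
  1≤e = IsSupremum.upper e-isSup (1 , ≈-sym (≈-trans (+-identityʳ _) 1/!-0))

  0<e : 0# < e
  0<e = 1≤⇒0< 1≤e

  -- Each partial sum is at most the inverse of `(1 - 1/N)^N`, hence so is `e`. The power vanishes
  -- for `N = 1`, where no inverse is available; this accounts for the case split.
  e*[1-1/N]^N≤1 : ∀ N → 1 ℕ.≤ N → e * (1# - fromℕ N ⁻¹) ^ N ≤ 1#
  e*[1-1/N]^N≤1 N 1≤N with (1# - fromℕ N ⁻¹) ^ N ≤? 0#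
  ... | yes z≤0 = ≤-trans (*-monoˡ-≤ (<⇒≤ 0<e) z≤0) (≤-respˡ-≈ (≈-sym (zeroʳ e)) 0≤1)
  ... | no  z≰0 = ≤-respʳ-≈ (*-inverseˡ 0<z) (*-monoʳ-≤ (<⇒≤ 0<z)
      (sup-≤ e-isSup λ s∈ → *≤1⇒≤⁻¹ 0<z ([1-1/N]^N*partialSum≤1 N 1≤N s∈)))
    where 0<z = ≰⇒> z≰0

  -- If yⁿ ≤ eᵐ with m ≤ u n, then y (1 - u) ≤ y (1 - 1/n)ᵐ by Bernoulli, and the
  -- n-th power of the latter is at most (e (1 - 1/n)ⁿ)ᵐ ≤ 1.
  e^ʳu*[1-u]≤1 : ∀ {u} → 0# ≤ u → u < 1# → e ^ʳ u * (1# - u) ≤ 1#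
  e^ʳu*[1-u]≤1 {u} 0≤u u<1 = ≤-respʳ-≈ (*-inverseˡ 0<1-u) (*-monoʳ-≤ (<⇒≤ 0<1-u)
    (sup-≤ (^ʳ-isSup 1≤e u) λ y∈ → *≤1⇒≤⁻¹ 0<1-u (≤-respˡ-≈ (*-comm _ _) (bound y∈))))
    where
    0<1-u = x<y⇒0<y-x u<1
    bound : ∀ {y} → y ∈ PowersBelow e u → y * (1# - u) ≤ 1#
    bound {y} y∈ =
      let (0<y , i , j , n , 1≤n , i≤un+j , yⁿeʲ≤eⁱ) = powersBelow-elim 0<e y∈
          -- Truncated subtraction is harmless: raising a negative `i - j` to 0 keeps it at most
          -- `u n`, as `u` is nonnegative, and only weakens the bound on `y ^ n`, as `1# ≤ e`.
          m = i ℕ.∸ j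
          h = fromℕ n ⁻¹
          0<n = fromℕ-pos 1≤n
          m≤un : fromℕ m ≤ u * fromℕ n
          m≤un = monus i j i≤un+j (*-nonNeg 0≤u (fromℕ-nonNeg n))
          yⁿ≤eᵐ : y ^ n ≤ e ^ m
          yⁿ≤eᵐ = ^-cancelʳ-factor i j m 0<e (^-nonNeg n (<⇒≤ 0<y)) yⁿeʲ≤eⁱ (ℕ.m≤n+m∸n i j) 1≤e
          mh≤u : fromℕ m * h ≤ u
          mh≤u = ≤-respʳ-≈ (≈-trans (*-assoc _ _ _) (≈-trans (*-congˡ (*-inverseʳ 0<n)) (*-identityʳ u)))
              (*-monoʳ-≤ (1/N-nonNeg n 1≤n) m≤un)
          0≤1-h = x≤y⇒0≤y-x (1/N≤1 n 1≤n)
          1-u≤ : 1# - u ≤ (1# - h) ^ m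
          1-u≤ = ≤-trans (+-mono-≤ ≤-refl (neg-mono-≤ mh≤u)) (bernoulli⁻ m (1/N-nonNeg n 1≤n) (1/N≤1 n 1≤n))
      in ^-cancel-≤ n 1≤n 0≤1 (begin
        (y * (1# - u)) ^ n           ≈⟨ ^-distrib-* y (1# - u) n ⟩
        y ^ n * (1# - u) ^ n
          ≤⟨ *-mono-≤ (^-nonNeg n (<⇒≤ 0<1-u)) (^-nonNeg m (<⇒≤ 0<e)) yⁿ≤eᵐ (^-mono-≤ n (<⇒≤ 0<1-u) 1-u≤) ⟩
        e ^ m * ((1# - h) ^ m) ^ n
          ≈⟨ *-congˡ (≈-trans (^-assocʳ _ m n) (≈-trans (^-congʳ _ (ℕ.*-comm m n)) (≈-sym (^-assocʳ _ n m)))) ⟩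
        e ^ m * ((1# - h) ^ n) ^ m   ≈⟨ ^-distrib-* e ((1# - h) ^ n) m ⟨
        (e * (1# - h) ^ n) ^ m
          ≤⟨ ^-mono-≤ m (*-nonNeg (<⇒≤ 0<e) (^-nonNeg n 0≤1-h)) (e*[1-1/N]^N≤1 n 1≤n) ⟩
        1# ^ m                       ≈⟨ 1^n≈1 m ⟩
        1#                           ≈⟨ 1^n≈1 n ⟨
        1# ^ n                       ∎)
      where
      monus : ∀ i j {x} → fromℕ i ≤ x + fromℕ j → 0# ≤ x → fromℕ (i ℕ.∸ j) ≤ x
      monus i       zero    p 0≤x = ≤-respʳ-≈ (+-identityʳ _) p
      monus zero    (suc j) p 0≤x = 0≤x
      monus (suc i) (suc j) {x} p 0≤x = monus i j (+-cancelʳ-≤ 1#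
        (≤-resp₂-≈ (+-comm _ _) (solve 2 (λ x j → x :+ (:1 :+ j) := (x :+ j) :+ :1) ≈-refl x (fromℕ j)) p)) 0≤x

-- σ-algebras, sums over bit vectors, and probability spaces.

module Probability (ℝ : RealField) where

  open RealField ℝ hiding (refl; sym; trans; zero)
  open Analysis ℝ using
    (_^_; fromℕ; sum; product; PartialSums; IsSigmaAlgebra; Borel; halfLine; ProbabilitySpace)
  open OrderedField ℝ

  -- Used twice: for the events of a probability space and for the Borel sets.
  module SigmaAlgebra {Ω : Set} {ℱ : Pred (Pred Ω 0ℓ) (lsuc 0ℓ)} (isSigmaAlgebra : IsSigmaAlgebra ℱ) where
    open IsSigmaAlgebra isSigmaAlgebra public

    empty : ℱ ∅
    empty = resp ((λ ¬⊤ → ¬⊤ _) , λ ()) (complement whole)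

    pair : Pred Ω 0ℓ → Pred Ω 0ℓ → ℕ → Pred Ω 0ℓ
    pair A B zero          = A
    pair A B (suc zero)    = B
    pair A B (suc (suc _)) = ∅

    pair-ℱ : ∀ {A B} → ℱ A → ℱ B → ∀ k → ℱ (pair A B k)
    pair-ℱ a b zero          = a
    pair-ℱ a b (suc zero)    = b
    pair-ℱ a b (suc (suc _)) = empty

    ⋃-pair : ∀ {A B} → ⋃ ℕ (pair A B) ≐ A ∪ B
    ⋃-pair = (λ { (zero , a) → inj₁ a ; (suc zero , b) → inj₂ b ; (suc (suc _) , ()) }) ,
             λ { (inj₁ a) → 0 , a ; (inj₂ b) → 1 , b }

    _∪ℱ_ : ∀ {A B} → ℱ A → ℱ B → ℱ (A ∪ B)
    a ∪ℱ b = resp ⋃-pair (union (pair-ℱ a b))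

    _∩ℱ_ : ∀ {A B} → ℱ A → ℱ B → ℱ (A ∩ B)
    _∩ℱ_ {A} {B} a b = resp (to , λ { (x , y) (inj₁ ¬x) → ¬x x ; (x , y) (inj₂ ¬y) → ¬y y })
      (complement (complement a ∪ℱ complement b))
      where
      to : ∁ (∁ A ∪ ∁ B) ⊆ A ∩ B
      to {ω} ¬∪ with excluded-middle (A ω) | excluded-middle (B ω)
      ... | yes x | yes y = x , y
      ... | no ¬x | _     = contradiction (inj₁ ¬x) ¬∪
      ... | _     | no ¬y = contradiction (inj₂ ¬y) ¬∪

    ⋂ℱ : ∀ {n} {A : Fin n → Pred Ω 0ℓ} → (∀ i → ℱ (A i)) → ℱ (⋂ (Fin n) A)
    ⋂ℱ {zero}  a = resp ((λ _ ()) , λ _ → _) whole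
    ⋂ℱ {suc n} a = resp ((λ { (p , q) zero → p ; (p , q) (suc i) → q i }) , λ p → p zero , p ∘ suc)
      (a zero ∩ℱ ⋂ℱ (a ∘ suc))

    -- Covers the empty sum, whose sublevel sets are either everything or nothing.
    constant : (Q : Set) → ℱ (λ _ → Q)
    constant Q with excluded-middle Q
    ... | yes q = resp ((λ _ → q) , λ _ → _) whole
    ... | no ¬q = resp ((λ ()) , ¬q) empty

  borel-isSigmaAlgebra : IsSigmaAlgebra Borel
  borel-isSigmaAlgebra = record { Borel }

  small-reciprocal : ∀ {x} → 0# < x → ∃[ k ] fromℕ (suc k) ⁻¹ ≤ x
  small-reciprocal {x} 0<x = let (n , 1/x≤n) = archimedean (x ⁻¹) ; 0<1+n = fromℕ-suc-pos n in
    n , *-cancelʳ-≤ 0<1+n (≤-resp₂-≈ (≈-sym (*-inverseˡ 0<1+n)) (*-comm _ _)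
      (≤-respˡ-≈ (*-inverseˡ 0<x) (*-monoʳ-≤ (<⇒≤ 0<x) (≤-trans 1/x≤n (≤-by 0≤1 (+-comm _ _))))))

  rational : ℕ → ℕ → ℕ → Carrier
  rational n i j = (fromℕ i - fromℕ j) * fromℕ (suc n) ⁻¹

  -- Needed for the measurability of sums; the indices are natural numbers so that countable unions
  -- can run over them.
  rationals-dense : ∀ {x y} → x < y → ∃[ n ] ∃[ i ] ∃[ j ] x < rational n i j × rational n i j < y
  rationals-dense {x} {y} x<y =
    let 0<d           = x<y⇒0<y-x x<y
        -- The numerator is the integer part of `x s` plus 2: weak rounding puts it at least 1 and
        -- at most 2 above `x s`, and a gap `s (y - x)` of 3 keeps it strictly below `y s`.
        (n , 3/d≤n)   = archimedean (fromℕ 3 * (y - x) ⁻¹)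
        s             = fromℕ (suc n)
        0<s           = fromℕ-suc-pos n
        (i , j , p , q) = floor (x * s)
        3≤sd : fromℕ 3 ≤ s * (y - x)
        3≤sd = ≤-respˡ-≈ (≈-trans (*-assoc _ _ _) (≈-trans (*-congˡ (*-inverseˡ 0<d)) (*-identityʳ _)))
          (*-monoʳ-≤ (<⇒≤ 0<d) (≤-trans 3/d≤n (≤-by 0≤1 (+-comm _ _))))
        k = fromℕ (suc (suc i)) - fromℕ j
        ks : rational n (suc (suc i)) j * s ≈ k
        ks = ≈-trans (*-assoc _ _ _) (≈-trans (*-congˡ (*-inverseˡ 0<s)) (*-identityʳ _))
    in n , suc (suc i) , j ,
       *-cancelʳ-< (<⇒≤ 0<s) (<-respʳ-≈ (≈-sym ks) (0<y-x⇒x<y (<-respʳ-≈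
         (solve 3 (λ x i j → :1 :+ ((i :+ :1) :- (x :+ j)) := (:1 :+ (:1 :+ i)) :- j :- x)
             ≈-refl (x * s) (fromℕ i) (fromℕ j))
         (+-pos-nonNeg 0<1 (x≤y⇒0≤y-x q))))) ,
       *-cancelʳ-< (<⇒≤ 0<s) (<-respˡ-≈ (≈-sym ks) (0<y-x⇒x<y (<-respʳ-≈
         (solve 5 (λ x y s i j → :1 :+ (((x :* s :+ j) :- i) :+
             (s :* (y :- x) :- (:1 :+ (:1 :+ (:1 :+ :0))))) := y :* s :- ((:1 :+ (:1 :+ i)) :- j))
                 ≈-refl x y s (fromℕ i) (fromℕ j))
         (+-pos-nonNeg 0<1 (+-nonNeg (x≤y⇒0≤y-x p) (x≤y⇒0≤y-x 3≤sd))))))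

  -- A point is the half-line up to `c` without the half-lines up to `c - 1/(k+1)`.
  borel-singleton : ∀ c → Borel (_≈ c)
  borel-singleton c = resp (to , from) (halfLine c ∩ℱ complement (union λ k → halfLine (c - fromℕ (suc k) ⁻¹)))
    where
    open SigmaAlgebra borel-isSigmaAlgebra
    below = ⋃ ℕ (λ k x → x ≤ c - fromℕ (suc k) ⁻¹)
    to : (_≤ c) ∩ ∁ below ⊆ (_≈ c)
    to {x} (x≤c , x∉below) = ≤-antisym x≤c (≮⇒≥ λ x<c →
      let (k , 1/k≤) = small-reciprocal (x<y⇒0<y-x x<c) in
      x∉below (k , ≤-by (x≤y⇒0≤y-x 1/k≤) (solve 3 (λ x c h → x :+ (c :- x :- h) := c :- h) ≈-refl x c _)))
    from : (_≈ c) ⊆ (_≤ c) ∩ ∁ below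
    from {x} x≈c = ≤-reflexive x≈c , λ (k , x≤c-h) → <⇒≱ (⁻¹-pos (fromℕ-suc-pos k))
      (≤-by (x≤y⇒0≤y-x (≤-respˡ-≈ x≈c x≤c-h)) (solve 2 (λ c h → h :+ ((c :- h) :- c) := :0) ≈-refl c _))

  bit : Bool → Carrier
  bit true  = 1#
  bit false = 0#

  -- The recursion on the first bit matches the case distinction on the first variable in
  -- `P-≤-sumCube`. Such finite sums take the place of expectations.
  sumCube : ∀ m → ((Fin m → Bool) → Carrier) → Carrier
  sumCube zero    f = f []
  sumCube (suc m) f = sumCube m (λ ε → f (true ∷ ε)) + sumCube m (λ ε → f (false ∷ ε))

  sumCube-cong : ∀ m {f g} → (∀ ε → f ε ≈ g ε) → sumCube m f ≈ sumCube m g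
  sumCube-cong zero    f≈g = f≈g []
  sumCube-cong (suc m) f≈g = +-cong (sumCube-cong m (λ ε → f≈g (true ∷ ε)))
      (sumCube-cong m (λ ε → f≈g (false ∷ ε)))

  -- The distributive law, that is, the binomial theorem before equal terms are collected. The
  -- factor `c` carries the bits already fixed through the induction.
  sumCube-product : ∀ m (c : Carrier) (g : Bool → Carrier) →
                    sumCube m (λ ε → c * product (g ∘ ε)) ≈ c * (g true + g false) ^ m
  sumCube-product zero    c g = ≈-refl
  sumCube-product (suc m) c g = ≈-trans (+-cong (half true) (half false))
    (solve 4 (λ c t f s → c :* t :* s :+ c :* f :* s := c :* ((t :+ f) :* s)) ≈-refl c (g true) (g false) _)
    where
    half : ∀ b → sumCube m (λ ε → c * (g b * product (g ∘ ε))) ≈ c * g b * (g true + g false) ^ m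
    half b = ≈-trans (sumCube-cong m (λ ε → ≈-sym (*-assoc c (g b) _))) (sumCube-product m (c * g b) g)

  count : ∀ {m} → (Fin m → Bool) → ℕ
  count {zero}  ε = 0
  count {suc m} ε with ε zero
  ... | true  = suc (count (ε ∘ suc))
  ... | false = count (ε ∘ suc)

  -- For `q = 1# - p` the mass function of b(p). The two values are independent because tilting
  -- changes `p` to `r` but keeps `1# - p`, without normalisation.
  weight : Carrier → Carrier → Bool → Carrier
  weight p q true  = p
  weight p q false = q

  -- The change of measure: every success yields one factor `q`.
  product-weight : ∀ {p q r s} → q * r ≈ p → ∀ {m} (ε : Fin m → Bool) →
                   product (weight p s ∘ ε) ≈ q ^ count ε * product (weight r s ∘ ε)
  product-weight qr≈p {zero}  ε = ≈-sym (*-identityˡ 1#)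
  product-weight {p} {q} {r} {s} qr≈p {suc m} ε with ε zero
  ... | true  = ≈-trans (*-cong (≈-sym qr≈p) (product-weight qr≈p (ε ∘ suc)))
    (solve 4 (λ q r Q T → q :* r :* (Q :* T) := q :* Q :* (r :* T)) ≈-refl q r _ _)
  ... | false = ≈-trans (*-congˡ (product-weight qr≈p (ε ∘ suc)))
    (solve 3 (λ s Q T → s :* (Q :* T) := Q :* (s :* T)) ≈-refl s _ _)

  sum-bits : ∀ {m} (x : Fin m → Carrier) ε → (∀ i → x i ≈ bit (ε i)) → sum x ≈ fromℕ (count ε)
  sum-bits {zero}  x ε eq = ≈-refl
  sum-bits {suc m} x ε eq with ε zero | eq zero
  ... | true  | x₀≈1 = +-cong x₀≈1 (sum-bits (x ∘ suc) (ε ∘ suc) (eq ∘ suc))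
  ... | false | x₀≈0 = ≈-trans (+-cong x₀≈0 (sum-bits (x ∘ suc) (ε ∘ suc) (eq ∘ suc))) (+-identityˡ _)

  product-cong : ∀ {m} {f g : Fin m → Carrier} → (∀ i → f i ≈ g i) → product f ≈ product g
  product-cong {zero}  f≈g = ≈-refl
  product-cong {suc m} f≈g = *-cong (f≈g zero) (product-cong (f≈g ∘ suc))

  product-nonNeg : ∀ {m} {f : Fin m → Carrier} → (∀ i → 0# ≤ f i) → 0# ≤ product f
  product-nonNeg {zero}  0≤f = 0≤1
  product-nonNeg {suc m} 0≤f = *-nonNeg (0≤f zero) (product-nonNeg (0≤f ∘ suc))

  module ProbabilityProperties (𝒫 : ProbabilitySpace) where
    open ProbabilitySpace 𝒫
    open SigmaAlgebra isSigmaAlgebra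
    open ≤-Reasoning

    -- Half-lines suffice for the event that a sum stays below a bound, so preimages of general
    -- Borel sets need not be followed through sums.
    Measurable : (Ω → Carrier) → Set₁
    Measurable Y = ∀ a → IsEvent (λ ω → Y ω ≤ a)

    randomVariable⇒measurable : ∀ {Y} → IsRandomVariable Y → Measurable Y
    randomVariable⇒measurable Y-rv a = Y-rv (halfLine a)

    -- `Y + Z` exceeds `a` exactly when some rational `q` satisfies `Y > q` and `Z > a - q`, a
    -- countable union of events.
    +-measurable : ∀ {Y Z} → Measurable Y → Measurable Z → Measurable (λ ω → Y ω + Z ω)
    +-measurable {Y} {Z} mY mZ a = resp (to , from)
      (complement (union λ n → union λ i → union λ j →
        complement (mY (rational n i j)) ∩ℱ complement (mZ (a - rational n i j))))
      where
      Above : Pred Ω 0ℓ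
      Above = ⋃ ℕ λ n → ⋃ ℕ λ i → ⋃ ℕ λ j →
        ∁ (λ ω → Y ω ≤ rational n i j) ∩ ∁ (λ ω → Z ω ≤ a - rational n i j)
      to : ∁ Above ⊆ (λ ω → Y ω + Z ω ≤ a)
      to {ω} ω∉Above = ≮⇒≥ λ a<Y+Z →
        let (n , i , j , lo , hi) = rationals-dense {a - Z ω} {Y ω} (0<y-x⇒x<y (<-respʳ-≈
              (solve 3 (λ y z a → (y :+ z) :- a := y :- (a :- z)) ≈-refl (Y ω) (Z ω) a) (x<y⇒0<y-x a<Y+Z)))
        in ω∉Above (n , i , j , <⇒≱ hi , λ Z≤a-q → <⇒≱ lo (≤-by (x≤y⇒0≤y-x Z≤a-q)
             (solve 3 (λ q z a → q :+ ((a :- q) :- z) := a :- z) ≈-refl (rational n i j) (Z ω) a)))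
      from : (λ ω → Y ω + Z ω ≤ a) ⊆ ∁ Above
      from {ω} Y+Z≤a (n , i , j , Y≰q , Z≰a-q) = Z≰a-q (≤-by
        (+-nonNeg (x≤y⇒0≤y-x Y+Z≤a) (x≤y⇒0≤y-x (<⇒≤ (≰⇒> Y≰q))))
        (solve 4 (λ q y z a → z :+ ((a :- (y :+ z)) :+ (y :- q)) := a :- q)
            ≈-refl (rational n i j) (Y ω) (Z ω) a))

    sum-measurable : ∀ {m} {Y : Fin m → Ω → Carrier} → (∀ i → Measurable (Y i)) → Measurable (λ ω → sum (λ i → Y i ω))
    sum-measurable {zero}  mY a = constant (0# ≤ a)
    sum-measurable {suc m} mY   = +-measurable (mY zero) (sum-measurable (mY ∘ suc))

    -- In the constant sequence `∅`, already two terms sum to at most the probability of the union,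
    -- which is again `∅`.
    P-∅ : P ∅ ≈ 0#
    P-∅ = ≤-antisym
      (+-cancelʳ-≤ (P ∅) (begin
        P ∅ + P ∅          ≈⟨ +-congˡ (+-identityʳ _) ⟨
        P ∅ + (P ∅ + 0#)
          ≤⟨ IsSupremum.upper (P-σ-additive {λ _ → ∅} (λ _ → empty) (λ _ _ → proj₁)) (2 , ≈-refl) ⟩
        P (⋃ ℕ λ _ → ∅)    ≈⟨ P-cong (union λ _ → empty) ((λ ()) , λ ()) ⟩
        P ∅                ≈⟨ +-identityˡ _ ⟨
        0# + P ∅           ∎))
      (P-nonNeg empty)

    -- σ-additivity for `A`, `B`, `∅`, `∅`, and so on: the supremum of the partial sums is attained
    -- after two terms.
    P-additive : ∀ {A B} → IsEvent A → IsEvent B → Empty (A ∩ B) → P (A ∪ B) ≈ P A + P B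
    P-additive {A} {B} a b A∩B=∅ = ≈-trans (≈-sym (P-cong (union (pair-ℱ a b)) ⋃-pair))
      (≤-antisym (sup-≤ isSup λ (k , x≈) → ≤-respˡ-≈ (≈-sym x≈) (bound k))
        (IsSupremum.upper isSup (2 , +-congˡ (≈-sym (+-identityʳ _)))))
      where
      disjoint : ∀ {j k} → ¬ j ≡ k → Empty (pair A B j ∩ pair A B k)
      disjoint {zero}        {zero}        j≢k = contradiction ≡.refl j≢k
      disjoint {zero}        {suc zero}    j≢k = A∩B=∅
      disjoint {suc zero}    {zero}        j≢k = λ ω (x , y) → A∩B=∅ ω (y , x)
      disjoint {suc zero}    {suc zero}    j≢k = contradiction ≡.refl j≢k
      disjoint {suc (suc _)} {_}           j≢k = λ ω → proj₁
      disjoint {zero}        {suc (suc _)} j≢k = λ ω → proj₂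
      disjoint {suc zero}    {suc (suc _)} j≢k = λ ω → proj₂
      isSup : IsSup (PartialSums (P ∘ pair A B)) (P (⋃ ℕ (pair A B)))
      isSup = P-σ-additive (pair-ℱ a b) disjoint
      zeros : ∀ k → sum {k} (λ _ → P ∅) ≈ 0#
      zeros zero    = ≈-refl
      zeros (suc k) = ≈-trans (+-cong P-∅ (zeros k)) (+-identityˡ 0#)
      bound : ∀ k → sum {k} (λ i → P (pair A B (toℕ i))) ≤ P A + P B
      bound zero          = +-nonNeg (P-nonNeg a) (P-nonNeg b)
      bound (suc zero)    = +-mono-≤ ≤-refl (P-nonNeg b)
      bound (suc (suc k)) = ≤-reflexive (+-congˡ (≈-trans (+-congˡ (zeros k)) (+-identityʳ _)))

    P-split : ∀ {A B} → IsEvent A → IsEvent B → P A ≈ P (A ∩ B) + P (A ∩ ∁ B)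
    P-split {A} {B} a b = ≈-trans (P-cong a (to , λ { (inj₁ (x , _)) → x ; (inj₂ (x , _)) → x }))
      (P-additive (a ∩ℱ b) (a ∩ℱ complement b) λ ω ((_ , y) , (_ , ¬y)) → ¬y y)
      where
      to : A ⊆ (A ∩ B) ∪ (A ∩ ∁ B)
      to {ω} x with excluded-middle (B ω)
      ... | yes y = inj₁ (x , y)
      ... | no ¬y = inj₂ (x , ¬y)

    P-mono : ∀ {A B} → IsEvent A → IsEvent B → A ⊆ B → P A ≤ P B
    P-mono {A} {B} a b A⊆B = ≤-by (P-nonNeg (b ∩ℱ complement a)) (≈-sym (≈-trans (P-split b a)
      (+-congʳ (P-cong (b ∩ℱ a) (proj₂ , λ x → A⊆B x , x)))))

    P-∪-≤ : ∀ {A B} → IsEvent A → IsEvent B → P (A ∪ B) ≤ P A + P B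
    P-∪-≤ {A} {B} a b = begin
      P (A ∪ B)                              ≈⟨ P-split (a ∪ℱ b) a ⟩
      P ((A ∪ B) ∩ A) + P ((A ∪ B) ∩ ∁ A)    ≤⟨ +-mono-≤
        (P-mono ((a ∪ℱ b) ∩ℱ a) a proj₂)
        (P-mono ((a ∪ℱ b) ∩ℱ complement a) b (λ { (inj₁ x , ¬x) → contradiction x ¬x ; (inj₂ y , _) → y })) ⟩
      P A + P B                              ∎

    ∼b⇒weight : ∀ {Y p} → Y ∼b p → ∀ b → P (λ ω → Y ω ≈ bit b) ≈ weight p (1# - p) b
    ∼b⇒weight (P₁ , P₀) true  = P₁
    ∼b⇒weight (P₁ , P₀) false = P₀

    -- `Y` may take other values, but only on a null set, because `p` and `1# - p` add up to 1.
    P-≤-split-bit : ∀ {p Y F} → IsRandomVariable Y → Y ∼b p → IsEvent F →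
                    P F ≤ P (F ∩ λ ω → Y ω ≈ 1#) + P (F ∩ λ ω → Y ω ≈ 0#)
    P-≤-split-bit {p} {Y} {F} Y-rv (P₁ , P₀) f = begin
      P F                                                       ≈⟨ P-split f (one ∪ℱ nil) ⟩
      P (F ∩ (One ∪ Nil)) + P (F ∩ ∁ (One ∪ Nil))               ≤⟨ +-mono-≤
        (P-mono (f ∩ℱ (one ∪ℱ nil)) ((f ∩ℱ one) ∪ℱ (f ∩ℱ nil)) λ { (x , inj₁ y) → inj₁ (x , y) ; (x , inj₂ y) → inj₂ (x , y) })
        (P-mono (f ∩ℱ complement (one ∪ℱ nil)) (complement (one ∪ℱ nil)) proj₂) ⟩
      P ((F ∩ One) ∪ (F ∩ Nil)) + P (∁ (One ∪ Nil))             ≈⟨ +-congˡ null ⟩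
      P ((F ∩ One) ∪ (F ∩ Nil)) + 0#                            ≈⟨ +-identityʳ _ ⟩
      P ((F ∩ One) ∪ (F ∩ Nil))                                 ≤⟨ P-∪-≤ (f ∩ℱ one) (f ∩ℱ nil) ⟩
      P (F ∩ One) + P (F ∩ Nil)                                 ∎
      where
      One Nil : Pred Ω 0ℓ
      One ω = Y ω ≈ 1#
      Nil ω = Y ω ≈ 0#
      one = Y-rv (borel-singleton 1#)
      nil = Y-rv (borel-singleton 0#)
      P-One∪Nil : P (One ∪ Nil) ≈ 1#
      P-One∪Nil = ≈-trans (P-additive one nil λ ω (Y≈1 , Y≈0) → 0≉1 (≈-trans (≈-sym Y≈0) Y≈1))
        (≈-trans (+-cong P₁ P₀) (solve 1 (λ p → p :+ (:1 :- p) := :1) ≈-refl p))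
      null : P (∁ (One ∪ Nil)) ≈ 0#
      null = begin-equality
        P (∁ (One ∪ Nil))
          ≈⟨ solve 2 (λ x y → x := (y :+ x) :- y) ≈-refl _ (P (One ∪ Nil)) ⟩
        (P (One ∪ Nil) + P (∁ (One ∪ Nil))) - P (One ∪ Nil)
          ≈⟨ +-congʳ (≈-trans (+-cong (P-cong (one ∪ℱ nil) ((λ x → _ , x) , proj₂))
              (P-cong (complement (one ∪ℱ nil)) ((λ x → _ , x) , proj₂)))
               (≈-sym (P-split whole (one ∪ℱ nil)))) ⟩
        P U - P (One ∪ Nil)   ≈⟨ +-cong P-whole (-‿cong P-One∪Nil) ⟩
        1# - 1#               ≈⟨ -‿inverseʳ 1# ⟩
        0#                    ∎

    Outcome : ∀ {m} → (Fin m → Ω → Carrier) → (Fin m → Bool) → Pred Ω 0ℓ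
    Outcome Y ε = ⋂ _ (λ i ω → Y i ω ≈ bit (ε i))

    outcome : ∀ {m} {Y : Fin m → Ω → Carrier} → (∀ i → IsRandomVariable (Y i)) → ∀ ε → IsEvent (Outcome Y ε)
    outcome Y-rv ε = ⋂ℱ (λ i → Y-rv i (borel-singleton (bit (ε i))))

    -- `F` is arbitrary so that the induction can absorb the value of the first variable into it.
    P-≤-sumCube : ∀ {m p} {Y : Fin m → Ω → Carrier} {F} {f} → (∀ i → IsRandomVariable (Y i)) → (∀ i → Y i ∼b p) →
                  IsEvent F → (∀ ε → P (F ∩ Outcome Y ε) ≤ f ε) → P F ≤ sumCube m f
    P-≤-sumCube {zero} Y-rv Y∼b F-ev bound =
      ≤-respˡ-≈ (P-cong (F-ev ∩ℱ outcome Y-rv []) (proj₁ , λ x → x , λ ())) (bound [])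
    P-≤-sumCube {suc m} {p} {Y} {F} {f} Y-rv Y∼b F-ev bound = ≤-trans
        (P-≤-split-bit (Y-rv zero) (Y∼b zero) F-ev)
      (+-mono-≤ (half true) (half false))
      where
      half : ∀ b → P (F ∩ λ ω → Y zero ω ≈ bit b) ≤ sumCube m (λ ε → f (b ∷ ε))
      half b = P-≤-sumCube (Y-rv ∘ suc) (Y∼b ∘ suc) F₀ λ ε → ≤-trans
        (P-mono (F₀ ∩ℱ outcome (Y-rv ∘ suc) ε) (F-ev ∩ℱ outcome Y-rv (b ∷ ε))
          λ ((x , y) , z) → x , λ { zero → y ; (suc i) → z i })
        (bound (b ∷ ε))
        where
        F₀ : IsEvent (F ∩ λ ω → Y zero ω ≈ bit b)
        F₀ = F-ev ∩ℱ Y-rv zero (borel-singleton (bit b))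

-- The tail estimate and its two closed forms.

module ChernoffBound (ℝ : RealField) where

  open RealField ℝ hiding (refl; sym; trans; zero)
  open Analysis ℝ using (_^_; _/_; fromℕ; sum; product; ProbabilitySpace; e; _^ʳ_)
  open OrderedField ℝ
  open Powers ℝ
  open PowerFunction ℝ
  open Exponential ℝ
  open Probability ℝ

  ⁻¹-unique : ∀ {x y} → 0# < x → x * y ≈ 1# → y ≈ x ⁻¹
  ⁻¹-unique {x} {y} 0<x xy≈1 = begin-equality
    y                ≈⟨ *-identityˡ _ ⟨
    1# * y           ≈⟨ *-congʳ (*-inverseˡ 0<x) ⟨
    x ⁻¹ * x * y     ≈⟨ *-assoc _ _ _ ⟩
    x ⁻¹ * (x * y)   ≈⟨ *-congˡ xy≈1 ⟩
    x ⁻¹ * 1#        ≈⟨ *-identityʳ _ ⟩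
    x ⁻¹             ∎
    where open ≤-Reasoning

  ⁻¹-distrib-* : ∀ {x y} → 0# < x → 0# < y → (x * y) ⁻¹ ≈ x ⁻¹ * y ⁻¹
  ⁻¹-distrib-* {x} {y} 0<x 0<y = ≈-sym (⁻¹-unique (*-pos 0<x 0<y) (≈-trans
    (solve 4 (λ x y x′ y′ → (x :* y) :* (x′ :* y′) := (x :* x′) :* (y :* y′)) ≈-refl x y (x ⁻¹) (y ⁻¹))
    (≈-trans (*-cong (*-inverseʳ 0<x) (*-inverseʳ 0<y)) (*-identityˡ 1#))))

  module Chernoff (𝒫 : ProbabilitySpace) where
    open ProbabilitySpace 𝒫
    open SigmaAlgebra isSigmaAlgebra
    open ProbabilityProperties 𝒫
    open ≤-Reasoning

    -- An outcome with more than `a` ones misses the event; one with `k ≤ a` ones has probability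
    -- `q ^ k` times its tilted weight. `W` stands for the real power `q^a`, of which only this
    -- domination of integer powers matters.
    tail-bound : ∀ {n p r q a W} {X : Fin n → Ω → Carrier} →
                 (∀ i → IsRandomVariable (X i)) → Independent X → (∀ i → X i ∼b p) →
                 p ≤ 1# → 0# ≤ r → q * r ≈ p → 0# ≤ W → (∀ k → fromℕ k ≤ a → q ^ k ≤ W) →
                 P (λ ω → sum (λ i → X i ω) ≤ a) ≤ W * (r + (1# - p)) ^ n
    tail-bound {n} {p} {r} {q} {a} {W} {X} X-rv X-ind X∼b p≤1 0≤r qr≈p 0≤W q^≤W = ≤-respʳ-≈
      (sumCube-product n W (weight r (1# - p)))
      (P-≤-sumCube X-rv X∼b F-ev bound)
      where
      F : Pred Ω _
      F ω = sum (λ i → X i ω) ≤ a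
      F-ev : IsEvent F
      F-ev = sum-measurable (λ i → randomVariable⇒measurable (X-rv i)) a
      0≤weight : ∀ b → 0# ≤ weight r (1# - p) b
      0≤weight true  = 0≤r
      0≤weight false = x≤y⇒0≤y-x p≤1
      P-outcome : ∀ ε → P (Outcome X ε) ≈ product (weight p (1# - p) ∘ ε)
      P-outcome ε = ≈-trans (X-ind (λ i → borel-singleton (bit (ε i))))
        (product-cong (λ i → ∼b⇒weight (X∼b i) (ε i)))
      bound : ∀ ε → P (F ∩ Outcome X ε) ≤ W * product (weight r (1# - p) ∘ ε)
      bound ε with fromℕ (count ε) ≤? a
      ... | yes k≤a = begin
        P (F ∩ Outcome X ε)
          ≤⟨ P-mono (F-ev ∩ℱ outcome X-rv ε) (outcome X-rv ε) proj₂ ⟩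
        P (Outcome X ε)                                ≈⟨ P-outcome ε ⟩
        product (weight p (1# - p) ∘ ε)                         ≈⟨ product-weight qr≈p ε ⟩
        q ^ count ε * product (weight r (1# - p) ∘ ε)
          ≤⟨ *-monoʳ-≤ (product-nonNeg (0≤weight ∘ ε)) (q^≤W (count ε) k≤a) ⟩
        W * product (weight r (1# - p) ∘ ε)                   ∎
      ... | no k≰a = begin
        P (F ∩ Outcome X ε)   ≤⟨ P-mono (F-ev ∩ℱ outcome X-rv ε) empty
                                   (λ (S≤a , x) → k≰a (≤-respˡ-≈ (sum-bits _ ε x) S≤a)) ⟩
        P (λ _ → _)           ≈⟨ P-∅ ⟩
        0#                    ≤⟨ *-nonNeg 0≤W (product-nonNeg (0≤weight ∘ ε)) ⟩
        W * product (weight r (1# - p) ∘ ε) ∎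

  module _ {p r δ : Carrier} (0<p : 0# < p) (r≈ : r ≈ (1# - δ) * p) where

    0<r<p⇔0<δ<1 : (0# < r × r < p) ⇔ (0# < δ × δ < 1#)
    0<r<p⇔0<δ<1 = mk⇔
      (λ (0<r , r<p) →
        0<y-x⇒x<y (<-respʳ-≈ (solve 1 (λ d → :1 :- (:1 :- d) := d :- :0) ≈-refl δ)
          (x<y⇒0<y-x (*-cancelʳ-< (<⇒≤ 0<p) (<-respˡ-≈ r≈ (<-respʳ-≈ (≈-sym (*-identityˡ p)) r<p))))) ,
        0<y-x⇒x<y (*-cancelʳ-< (<⇒≤ 0<p) (<-respˡ-≈ (≈-sym (zeroˡ p)) (<-respʳ-≈ r≈ 0<r))))
      (λ (0<δ , δ<1) →
        <-respʳ-≈ (≈-sym r≈) (*-pos (x<y⇒0<y-x δ<1) 0<p) ,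
        0<y-x⇒x<y (<-respʳ-≈ (≈-trans (solve 2 (λ d p → d :* p := p :- (:1 :- d) :* p)
            ≈-refl δ p) (+-congˡ (-‿cong (≈-sym r≈)))) (*-pos 0<δ 0<p)))

    module Bound (0<r : 0# < r) (r<p : r < p) (p<1 : p < 1#) (n : ℕ) where
      open ≤-Reasoning

      private
        1-δ = 1# - δ

        -- The base is split into `A = e^(r-p)` and `w = (p/r)^r`, which bound the tilted mass and
        -- the cost of tilting.
        A = e ^ʳ r / e ^ʳ p
        w = p ^ʳ r / r ^ʳ r
        0<eᵖ = ^ʳ-pos 0<e p
        0<rʳ = ^ʳ-pos 0<r r

        0<1-δ : 0# < 1-δ
        0<1-δ = *-cancelʳ-< (<⇒≤ 0<p) (<-respˡ-≈ (≈-sym (zeroˡ p)) (<-respʳ-≈ r≈ 0<r))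

        0<p/r : 0# < p / r
        0<p/r = *-pos 0<p (⁻¹-pos 0<r)

        A-isPow : IsPow e (r - p) A
        A-isPow = isPow-+ 0<e (^ʳ-isPow 0<e r) (isPow-⁻¹-exponent (^ʳ-isPow 0<e p))

        w-isPow : IsPow (p / r) r w
        w-isPow = isPow-distrib-* 0<p (⁻¹-pos 0<r) (^ʳ-isPow 0<p r) (isPow-⁻¹-base 0<r (^ʳ-isPow 0<r r))

        p/r≈[1-δ]⁻¹ : p / r ≈ 1-δ ⁻¹
        p/r≈[1-δ]⁻¹ = ⁻¹-unique 0<1-δ (begin-equality
          1-δ * (p * r ⁻¹)   ≈⟨ *-assoc _ _ _ ⟨
          1-δ * p * r ⁻¹     ≈⟨ *-congʳ r≈ ⟨
          r * r ⁻¹           ≈⟨ *-inverseʳ 0<r ⟩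
          1#                 ∎)

      base = (e ^ʳ r * p ^ʳ r) / (e ^ʳ p * r ^ʳ r)

      base^n≈ : base ^ n ≈ w ^ n * A ^ n
      base^n≈ = ≈-trans (^-congˡ n (begin-equality
        e ^ʳ r * p ^ʳ r * (e ^ʳ p * r ^ʳ r) ⁻¹
          ≈⟨ *-congˡ (⁻¹-distrib-* 0<eᵖ 0<rʳ) ⟩
        e ^ʳ r * p ^ʳ r * ((e ^ʳ p) ⁻¹ * (r ^ʳ r) ⁻¹)
          ≈⟨ solve 4 (λ a b c d → a :* b :* (c :* d) := (b :* d) :* (a :* c)) ≈-refl _ _ _ _ ⟩
        w * A ∎)) (^-distrib-* w A n)

      -- This is `1 - u ≤ e^(-u)` at `u = p - r`, which is below 1 since `0# < r` and `p < 1#`.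
      1-[p-r]≤A : r + (1# - p) ≤ A
      1-[p-r]≤A = begin
        r + (1# - p)          ≈⟨ solve 2 (λ r p → r :+ (:1 :- p) := :1 :- (p :- r)) ≈-refl r p ⟩
        1# - u                ≤⟨ *≤1⇒≤⁻¹ (^ʳ-pos 0<e u) (e^ʳu*[1-u]≤1 (x≤y⇒0≤y-x (<⇒≤ r<p)) u<1) ⟩
        (e ^ʳ u) ⁻¹
          ≈⟨ isPow-unique 0<e (isPow-cong ≈-refl (solve 2 (λ r p → :- (p :- r) := r :- p) ≈-refl r p) ≈-refl
                                   (isPow-⁻¹-exponent (^ʳ-isPow 0<e u))) A-isPow ⟩
        A                     ∎
        where
        u = p - r
        u<1 : u < 1#
        u<1 = ≤-<-trans (≤-by (<⇒≤ 0<r) (solve 2 (λ p r → (p :- r) :+ r := p) ≈-refl p r)) p<1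

      -- `w ^ n` is the real power of `p / r` with exponent `r n`. As `p / r ≥ 1`, the integer power
      -- belongs to the set whose supremum this is.
      [p/r]^k≤wⁿ : ∀ k → fromℕ k ≤ (1# - δ) * p * fromℕ n → (p / r) ^ k ≤ w ^ n
      [p/r]^k≤wⁿ k k≤ = ≤-respʳ-≈ (isPow-unique 0<p/r (^ʳ-isPow 0<p/r (r * fromℕ n)) (isPow-^ n w-isPow))
        (^≤^ʳ k (≤-respˡ-≈ (*-inverseʳ 0<r) (*-monoʳ-≤ (<⇒≤ (⁻¹-pos 0<r)) (<⇒≤ r<p)))
          (≤-respʳ-≈ (*-congʳ (≈-sym r≈)) k≤))

      0≤wⁿ : 0# ≤ w ^ n
      0≤wⁿ = <⇒≤ (^-pos n (IsPow.positive w-isPow))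

      wⁿ*[r+1-p]ⁿ≤baseⁿ : w ^ n * (r + (1# - p)) ^ n ≤ base ^ n
      wⁿ*[r+1-p]ⁿ≤baseⁿ = ≤-respʳ-≈ (≈-sym base^n≈)
        (*-monoˡ-≤ 0≤wⁿ (^-mono-≤ n (+-nonNeg (<⇒≤ 0<r) (x≤y⇒0≤y-x (<⇒≤ p<1))) 1-[p-r]≤A))

      -- Uniqueness of powers, twice: `A ^ n` and `E ^ʳ y` are both the power of `e` with exponent
      -- `(r - p) n = - δ p n`; `w ^ n` and the inverse of `D ^ʳ y` are both the power of
      -- `p / r = 1 / (1 - δ)` with exponent `r n = (1 - δ) p n`.
      baseⁿ≈ : base ^ n ≈ (e ^ʳ (- δ) / (1# - δ) ^ʳ (1# - δ)) ^ʳ (p * fromℕ n)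
      baseⁿ≈ = begin-equality
        base ^ n              ≈⟨ base^n≈ ⟩
        w ^ n * A ^ n         ≈⟨ *-comm _ _ ⟩
        A ^ n * w ^ n         ≈⟨ *-cong Aⁿ≈ wⁿ≈ ⟩
        E ^ʳ y * (D ^ʳ y) ⁻¹  ≈⟨ isPow-unique (*-pos 0<E (⁻¹-pos 0<D))
                                   (isPow-distrib-* 0<E (⁻¹-pos 0<D) (^ʳ-isPow 0<E y)
                                       (isPow-⁻¹-base 0<D (^ʳ-isPow 0<D y)))
                                   (^ʳ-isPow (*-pos 0<E (⁻¹-pos 0<D)) y) ⟩
        (E / D) ^ʳ y          ∎
        where
        y = p * fromℕ n
        E = e ^ʳ (- δ)
        D = 1-δ ^ʳ 1-δ
        0<E = ^ʳ-pos 0<e (- δ)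
        0<D = ^ʳ-pos 0<1-δ 1-δ
        Aⁿ≈ : A ^ n ≈ E ^ʳ y
        Aⁿ≈ = isPow-unique 0<e (isPow-^ n A-isPow) (isPow-cong ≈-refl
          (≈-trans (solve 3 (λ d p n → (:- d) :* (p :* n) := ((:1 :- d) :* p :- p) :* n) ≈-refl δ p (fromℕ n))
            (*-congʳ (+-congʳ (≈-sym r≈)))) ≈-refl
          (isPow-* 0<e (^ʳ-isPow 0<e (- δ)) (^ʳ-isPow 0<E y)))
        wⁿ≈ : w ^ n ≈ (D ^ʳ y) ⁻¹
        wⁿ≈ = isPow-unique 0<p/r (isPow-^ n w-isPow) (isPow-cong (≈-sym p/r≈[1-δ]⁻¹)
          (≈-trans (≈-sym (*-assoc _ _ _)) (*-congʳ (≈-sym r≈))) ≈-refl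
          (isPow-⁻¹-base 0<1-δ (isPow-* 0<1-δ (^ʳ-isPow 0<1-δ 1-δ) (^ʳ-isPow 0<D y))))

lemma8 :
  (ℝ : RealField) → let open Analysis ℝ in
  (𝒫 : ProbabilitySpace) → let open ProbabilitySpace 𝒫 in
  (n : ℕ) → n ≥ 1 →
  (p : Carrier) → 0# < p → p < 1# →
  (X : Fin n → Ω → Carrier) →
  (∀ i → IsRandomVariable (X i)) →
  Independent X →
  (∀ i → X i ∼b p) →
  let S : Ω → Carrier
      S ω = sum (λ i → X i ω)
  in
  (r δ : Carrier) → r ≈ (1# - δ) * p →
  ((0# < r × r < p) ⇔ (0# < δ × δ < 1#)) ×
  (0# < r × r < p →
    P (λ ω → S ω ≤ r * fromℕ n) ≈ P (λ ω → S ω ≤ (1# - δ) * p * fromℕ n) ×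
    P (λ ω → S ω ≤ (1# - δ) * p * fromℕ n)
      ≤ ((e ^ʳ r * p ^ʳ r) / (e ^ʳ p * r ^ʳ r)) ^ n ×
    ((e ^ʳ r * p ^ʳ r) / (e ^ʳ p * r ^ʳ r)) ^ n
      ≈ (e ^ʳ (- δ) / (1# - δ) ^ʳ (1# - δ)) ^ʳ (p * fromℕ n))
lemma8 ℝ 𝒫 n _ p 0<p p<1 X X-rv X-ind X∼b r δ r≈ = 0<r<p⇔0<δ<1 0<p r≈ , λ (0<r , r<p) →
  let open Bound 0<p r≈ 0<r r<p p<1 n
      rn≈ = *-congʳ r≈
  in
  P-cong (sum-measurable (λ i → randomVariable⇒measurable (X-rv i)) (r * fromℕ n))
    (≤-respʳ-≈ rn≈ , ≤-respʳ-≈ (≈-sym rn≈)) ,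
  -- The implicit `q` is `p / r`, and `W` is the n-th power of `(p/r)^r`.
  ≤-trans (tail-bound X-rv X-ind X∼b (<⇒≤ p<1) (<⇒≤ 0<r) (*-/-cancel 0<r) 0≤wⁿ [p/r]^k≤wⁿ)
    wⁿ*[r+1-p]ⁿ≤baseⁿ ,
  baseⁿ≈
  where
  open Analysis ℝ using (module ProbabilitySpace; _*_; fromℕ)
  open ProbabilitySpace 𝒫 using (P-cong)
  open RealField ℝ using (*-congʳ)
  open OrderedField ℝ using (≈-sym; ≤-respʳ-≈; ≤-trans; <⇒≤)
  open Powers ℝ using (*-/-cancel)
  open Probability ℝ using (module ProbabilityProperties)
  open ProbabilityProperties 𝒫 using (sum-measurable; randomVariable⇒measurable)
  open ChernoffBound ℝ using (0<r<p⇔0<δ<1; module Bound; module Chernoff)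
  open Chernoff 𝒫 using (tail-bound)
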